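{- For every $n\ge3$, no vertex of the unweighted path $P_n$ is sedentary.
   Context: For a graph with adjacency matrix $A$, $U(t)=e^{itA}$. A vertex $u$ is sedentary if $\inf_{t>0}|U(t)_{u,u}|\ge C$ for some constant $0<C\le1$, and not sedentary if $\inf_{t>0}|U(t)_{u,u}|=0$. -}

module Defs where

open import Algebra.Bundles.Raw using (RawRing)
import Algebra.Definitions.RawSemiring as RawSemiringDefs
open import Data.Bool.Base using (if_then_else_)
open import Data.Fin.Base using (Fin; toℕ)
import Data.Fin.Properties as Fin
open import Data.Integer.Base using (1ℤ)
open import Data.Nat.Base as ℕ using (ℕ; suc; _⊔_; _!)
import Data.Nat.Properties as ℕ
open import Data.Product.Base using (_×_; _,_; ∃-syntax)
open import Data.Rational.Base as ℚ using (ℚ; 0ℚ; 1ℚ; ½; ∣_∣)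
import Data.Rational.Properties as ℚ
open import Data.Rational.Solver using (module +-*-Solver)
open import Data.Sum.Base using (_⊎_; inj₁; inj₂; swap)
open import Function.Base using (_∘_)
open import Level using (0ℓ)
open import Relation.Binary.Core using (Rel)
open import Relation.Binary.Definitions using (Symmetric; Irreflexive; Decidable)
open import Relation.Binary.PropositionalEquality
  using (_≡_; refl; sym; trans; cong; cong₂; subst)
open import Relation.Nullary using (¬_; does)
open import Relation.Nullary.Decidable using (_⊎-dec_)
open import Relation.Unary using (Pred; _∈_)

-- Reals are Cauchy sequences of rationals with a modulus; their equality is _≈_, not _≡_.

IsCauchy : (ℕ → ℚ) → Set
IsCauchy x = ∀ ε → 0ℚ ℚ.< ε →
  ∃[ N ] (∀ m n → N ℕ.≤ m → N ℕ.≤ n → ∣ x m ℚ.- x n ∣ ℚ.< ε)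

record ℝ : Set where
  constructor mkℝ
  field
    seq    : ℕ → ℚ
    cauchy : IsCauchy seq

open ℝ public

infix 4 _<_ _≤_ _≈_

_<_ : Rel ℝ 0ℓ
x < y = ∃[ ε ] (0ℚ ℚ.< ε × ∃[ N ] (∀ m → N ℕ.≤ m → seq x m ℚ.+ ε ℚ.< seq y m))

_≤_ : Rel ℝ 0ℓ
x ≤ y = ∀ ε → 0ℚ ℚ.< ε → ∃[ N ] (∀ m → N ℕ.≤ m → seq x m ℚ.< seq y m ℚ.+ ε)

_≈_ : Rel ℝ 0ℓ
x ≈ y = x ≤ y × y ≤ x

private abstract

  0<½ : 0ℚ ℚ.< ½
  0<½ = ℚ.positive⁻¹ ½

  0<1 : 0ℚ ℚ.< 1ℚ
  0<1 = ℚ.positive⁻¹ 1ℚ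

  half>0 : ∀ ε → 0ℚ ℚ.< ε → 0ℚ ℚ.< ½ ℚ.* ε
  half>0 ε ε>0 = subst (ℚ._< ½ ℚ.* ε) (ℚ.*-zeroʳ ½) (ℚ.*-monoʳ-<-pos ½ ε>0)

  halves : ∀ ε → ½ ℚ.* ε ℚ.+ ½ ℚ.* ε ≡ ε
  halves ε = trans (sym (ℚ.*-distribʳ-+ ε ½ ½)) (ℚ.*-identityˡ ε)

  const-cauchy : ∀ q → IsCauchy (λ _ → q)
  const-cauchy q ε ε>0 = 0 , λ _ _ _ _ → subst (ℚ._< ε) (sym (cong ∣_∣ (ℚ.+-inverseʳ q))) ε>0

  +-cauchy : ∀ {x y} → IsCauchy x → IsCauchy y → IsCauchy (λ m → x m ℚ.+ y m)
  +-cauchy {x} {y} cx cy ε ε>0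
    with (N , p) ← cx (½ ℚ.* ε) (half>0 ε ε>0)
       | (M , q) ← cy (½ ℚ.* ε) (half>0 ε ε>0) = N ⊔ M , bound
    where
    open ℚ.≤-Reasoning
    open +-*-Solver
    bound : ∀ m n → N ⊔ M ℕ.≤ m → N ⊔ M ℕ.≤ n →
            ∣ (x m ℚ.+ y m) ℚ.- (x n ℚ.+ y n) ∣ ℚ.< ε
    bound m n m≥ n≥ = begin-strict
      ∣ (x m ℚ.+ y m) ℚ.- (x n ℚ.+ y n) ∣
        ≡⟨ cong ∣_∣ (solve 4 (λ a b c d → (a :+ b) :- (c :+ d) := (a :- c) :+ (b :- d))
             refl (x m) (y m) (x n) (y n)) ⟩
      ∣ (x m ℚ.- x n) ℚ.+ (y m ℚ.- y n) ∣
        ≤⟨ ℚ.∣p+q∣≤∣p∣+∣q∣ (x m ℚ.- x n) (y m ℚ.- y n) ⟩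
      ∣ x m ℚ.- x n ∣ ℚ.+ ∣ y m ℚ.- y n ∣
        <⟨ ℚ.+-mono-< (p m n (ℕ.m⊔n≤o⇒m≤o N M m≥) (ℕ.m⊔n≤o⇒m≤o N M n≥))
                      (q m n (ℕ.m⊔n≤o⇒n≤o N M m≥) (ℕ.m⊔n≤o⇒n≤o N M n≥)) ⟩
      ½ ℚ.* ε ℚ.+ ½ ℚ.* ε
        ≡⟨ halves ε ⟩
      ε ∎

  neg-cauchy : ∀ {x} → IsCauchy x → IsCauchy (λ m → ℚ.- x m)
  neg-cauchy {x} cx ε ε>0 with (N , p) ← cx ε ε>0 =
    N , λ m n m≥ n≥ → subst (ℚ._< ε) (sym (flip-sign m n)) (p m n m≥ n≥)
    where
    open +-*-Solver
    flip-sign : ∀ m n → ∣ ℚ.- x m ℚ.- ℚ.- x n ∣ ≡ ∣ x m ℚ.- x n ∣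
    flip-sign m n = trans
      (cong ∣_∣ (solve 2 (λ a b → :- a :- (:- b) := :- (a :- b)) refl (x m) (x n)))
      (ℚ.∣-p∣≡∣p∣ (x m ℚ.- x n))

  EventuallyBounded : (ℕ → ℚ) → Set
  EventuallyBounded x = ∃[ B ] (0ℚ ℚ.< B × ∃[ N ] (∀ m → N ℕ.≤ m → ∣ x m ∣ ℚ.≤ B))

  eventually-bounded : ∀ {x} → IsCauchy x → EventuallyBounded x
  eventually-bounded {x} cx with (N , p) ← cx 1ℚ 0<1 =
    1ℚ ℚ.+ ∣ x N ∣ , ℚ.+-mono-<-≤ 0<1 (ℚ.0≤∣p∣ (x N)) , N , bound
    where
    open ℚ.≤-Reasoning
    open +-*-Solver
    bound : ∀ m → N ℕ.≤ m → ∣ x m ∣ ℚ.≤ 1ℚ ℚ.+ ∣ x N ∣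
    bound m m≥ = begin
      ∣ x m ∣
        ≡⟨ cong ∣_∣ (solve 2 (λ a b → a := (a :- b) :+ b) refl (x m) (x N)) ⟩
      ∣ (x m ℚ.- x N) ℚ.+ x N ∣
        ≤⟨ ℚ.∣p+q∣≤∣p∣+∣q∣ (x m ℚ.- x N) (x N) ⟩
      ∣ x m ℚ.- x N ∣ ℚ.+ ∣ x N ∣
        ≤⟨ ℚ.+-monoˡ-≤ ∣ x N ∣ (ℚ.<⇒≤ (p m N m≥ ℕ.≤-refl)) ⟩
      1ℚ ℚ.+ ∣ x N ∣ ∎

  divide : ∀ D ε → 0ℚ ℚ.< D → 0ℚ ℚ.< ε → ∃[ δ ] (0ℚ ℚ.< δ × D ℚ.* δ ≡ ε)
  divide D ε D>0 ε>0 = (ℚ.1/ D) ℚ.* ε , δ>0 ,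
    trans (sym (ℚ.*-assoc D (ℚ.1/ D) ε))
      (trans (cong (ℚ._* ε) (ℚ.*-inverseʳ D)) (ℚ.*-identityˡ ε))
    where
    instance
      D⁺ : ℚ.Positive D
      D⁺ = ℚ.positive D>0
      D≢0 : ℚ.NonZero D
      D≢0 = ℚ.pos⇒nonZero D
    δ>0 : 0ℚ ℚ.< (ℚ.1/ D) ℚ.* ε
    δ>0 = subst (ℚ._< (ℚ.1/ D) ℚ.* ε) (ℚ.*-zeroʳ (ℚ.1/ D))
            (ℚ.*-monoʳ-<-pos (ℚ.1/ D) {{ℚ.1/pos⇒pos D}} ε>0)

  product-bound : ∀ {B C δ} a b c d → 0ℚ ℚ.< B → 0ℚ ℚ.< C →
    ∣ a ∣ ℚ.≤ B → ∣ d ∣ ℚ.≤ C → ∣ a ℚ.- c ∣ ℚ.< δ → ∣ b ℚ.- d ∣ ℚ.< δ →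
    ∣ a ℚ.* b ℚ.- c ℚ.* d ∣ ℚ.< (B ℚ.+ C) ℚ.* δ
  product-bound {B} {C} {δ} a b c d B>0 C>0 a≤B d≤C ac<δ bd<δ = begin-strict
    ∣ a ℚ.* b ℚ.- c ℚ.* d ∣
      ≡⟨ cong ∣_∣ (solve 4 (λ a b c d → a :* b :- c :* d := a :* (b :- d) :+ d :* (a :- c))
           refl a b c d) ⟩
    ∣ a ℚ.* (b ℚ.- d) ℚ.+ d ℚ.* (a ℚ.- c) ∣
      ≤⟨ ℚ.∣p+q∣≤∣p∣+∣q∣ (a ℚ.* (b ℚ.- d)) (d ℚ.* (a ℚ.- c)) ⟩
    ∣ a ℚ.* (b ℚ.- d) ∣ ℚ.+ ∣ d ℚ.* (a ℚ.- c) ∣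
      ≡⟨ cong₂ ℚ._+_ (ℚ.∣p*q∣≡∣p∣*∣q∣ a (b ℚ.- d)) (ℚ.∣p*q∣≡∣p∣*∣q∣ d (a ℚ.- c)) ⟩
    ∣ a ∣ ℚ.* ∣ b ℚ.- d ∣ ℚ.+ ∣ d ∣ ℚ.* ∣ a ℚ.- c ∣
      ≤⟨ ℚ.+-mono-≤
           (ℚ.*-monoʳ-≤-nonNeg ∣ b ℚ.- d ∣ {{ℚ.∣-∣-nonNeg (b ℚ.- d)}} a≤B)
           (ℚ.*-monoʳ-≤-nonNeg ∣ a ℚ.- c ∣ {{ℚ.∣-∣-nonNeg (a ℚ.- c)}} d≤C) ⟩
    B ℚ.* ∣ b ℚ.- d ∣ ℚ.+ C ℚ.* ∣ a ℚ.- c ∣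
      <⟨ ℚ.+-mono-< (ℚ.*-monoʳ-<-pos B {{ℚ.positive B>0}} bd<δ)
                    (ℚ.*-monoʳ-<-pos C {{ℚ.positive C>0}} ac<δ) ⟩
    B ℚ.* δ ℚ.+ C ℚ.* δ
      ≡⟨ ℚ.*-distribʳ-+ δ B C ⟨
    (B ℚ.+ C) ℚ.* δ ∎
    where
    open ℚ.≤-Reasoning
    open +-*-Solver

  *-cauchy : ∀ {x y} → IsCauchy x → IsCauchy y → IsCauchy (λ m → x m ℚ.* y m)
  *-cauchy {x} {y} cx cy ε ε>0 = bounded (eventually-bounded cx) (eventually-bounded cy)
    where
    Goal : Set
    Goal = ∃[ N ] (∀ m n → N ℕ.≤ m → N ℕ.≤ n → ∣ x m ℚ.* y m ℚ.- x n ℚ.* y n ∣ ℚ.< ε)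

    bounded : EventuallyBounded x → EventuallyBounded y → Goal
    bounded (B , B>0 , N₁ , xB) (C , C>0 , M₁ , yC) =
      scaled (divide (B ℚ.+ C) ε (ℚ.+-mono-< B>0 C>0) ε>0)
      where
      scaled : ∃[ δ ] (0ℚ ℚ.< δ × (B ℚ.+ C) ℚ.* δ ≡ ε) → Goal
      scaled (δ , δ>0 , Dδ≡ε) with (N₂ , p) ← cx δ δ>0 | (M₂ , q) ← cy δ δ>0 =
        (N₁ ⊔ M₁) ⊔ (N₂ ⊔ M₂) , λ m n m≥ n≥ →
        subst (∣ x m ℚ.* y m ℚ.- x n ℚ.* y n ∣ ℚ.<_) Dδ≡ε
          (product-bound (x m) (y m) (x n) (y n) B>0 C>0
            (xB m (N₁≤ m≥)) (yC n (M₁≤ n≥))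
            (p m n (N₂≤ m≥) (N₂≤ n≥)) (q m n (M₂≤ m≥) (M₂≤ n≥)))
        where
        N₁≤ : ∀ {k} → (N₁ ⊔ M₁) ⊔ (N₂ ⊔ M₂) ℕ.≤ k → N₁ ℕ.≤ k
        N₁≤ = ℕ.m⊔n≤o⇒m≤o N₁ M₁ ∘ ℕ.m⊔n≤o⇒m≤o (N₁ ⊔ M₁) (N₂ ⊔ M₂)
        M₁≤ : ∀ {k} → (N₁ ⊔ M₁) ⊔ (N₂ ⊔ M₂) ℕ.≤ k → M₁ ℕ.≤ k
        M₁≤ = ℕ.m⊔n≤o⇒n≤o N₁ M₁ ∘ ℕ.m⊔n≤o⇒m≤o (N₁ ⊔ M₁) (N₂ ⊔ M₂)
        N₂≤ : ∀ {k} → (N₁ ⊔ M₁) ⊔ (N₂ ⊔ M₂) ℕ.≤ k → N₂ ℕ.≤ k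
        N₂≤ = ℕ.m⊔n≤o⇒m≤o N₂ M₂ ∘ ℕ.m⊔n≤o⇒n≤o (N₁ ⊔ M₁) (N₂ ⊔ M₂)
        M₂≤ : ∀ {k} → (N₁ ⊔ M₁) ⊔ (N₂ ⊔ M₂) ℕ.≤ k → M₂ ℕ.≤ k
        M₂≤ = ℕ.m⊔n≤o⇒n≤o N₂ M₂ ∘ ℕ.m⊔n≤o⇒n≤o (N₁ ⊔ M₁) (N₂ ⊔ M₂)

fromℚ : ℚ → ℝ
fromℚ q = mkℝ (λ _ → q) (const-cauchy q)

0ℝ 1ℝ : ℝ
0ℝ = fromℚ 0ℚ
1ℝ = fromℚ 1ℚ

infix  8 -_
infixl 7 _*_
infixl 6 _+_

_+_ _*_ : ℝ → ℝ → ℝ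
x + y = mkℝ (λ m → seq x m ℚ.+ seq y m) (+-cauchy {seq x} {seq y} (cauchy x) (cauchy y))
x * y = mkℝ (λ m → seq x m ℚ.* seq y m) (*-cauchy {seq x} {seq y} (cauchy x) (cauchy y))

-_ : ℝ → ℝ
- x = mkℝ (λ m → ℚ.- seq x m) (neg-cauchy {seq x} (cauchy x))

-- Constructive infimum: a lower bound approached arbitrarily closely from within S.
IsInfimum : Pred ℝ 0ℓ → ℝ → Set
IsInfimum S i = (∀ r → r ∈ S → i ≤ r)
              × (∀ ε → 0ℝ < ε → ∃[ r ] (r ∈ S × r < i + ε))

record ℂ : Set where
  constructor _+i_
  field
    re im : ℝ

open ℂ public

ℂ-rawRing : RawRing 0ℓ 0ℓ
ℂ-rawRing = record
  { Carrier = ℂ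
  ; _≈_     = λ z w → re z ≈ re w × im z ≈ im w
  ; _+_     = λ z w → (re z + re w) +i (im z + im w)
  ; _*_     = λ z w → (re z * re w + - (im z * im w)) +i (re z * im w + im z * re w)
  ; -_      = λ z → (- re z) +i (- im z)
  ; 0#      = 0ℝ +i 0ℝ
  ; 1#      = 1ℝ +i 0ℝ
  }

module ℂR where
  open RawRing ℂ-rawRing public
  open RawSemiringDefs (RawRing.rawSemiring ℂ-rawRing) public using (sum)

fromℝ : ℝ → ℂ
fromℝ x = x +i 0ℝ

i : ℂ
i = 0ℝ +i 1ℝ

∣_∣² : ℂ → ℝ
∣ z ∣² = re z * re z + im z * im z

-- r = |z|, the non-negative square root of |z|².
IsModulus : ℂ → ℝ → Set
IsModulus z r = 0ℝ ≤ r × r * r ≈ ∣ z ∣²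

-- |s m - z| < ε is written as |s m - z|² < ε².
_⟶_ : (ℕ → ℂ) → ℂ → Set
s ⟶ z = ∀ ε → 0ℝ < ε → ∃[ N ] (∀ m → N ℕ.≤ m → ∣ s m ℂR.+ ℂR.- z ∣² < ε * ε)

Matrix : ℕ → Set
Matrix n = Fin n → Fin n → ℂ

Matrix-rawRing : ℕ → RawRing 0ℓ 0ℓ
Matrix-rawRing n = record
  { Carrier = Matrix n
  ; _≈_     = λ M N → ∀ a b → M a b ℂR.≈ N a b
  ; _+_     = λ M N a b → M a b ℂR.+ N a b
  ; _*_     = λ M N a b → ℂR.sum (λ c → M a c ℂR.* N c b)
  ; -_      = λ M a b → ℂR.- M a b
  ; 0#      = λ _ _ → ℂR.0#
  ; 1#      = λ a b → if does (a Fin.≟ b) then ℂR.1# else ℂR.0#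
  }

1/_! : ℕ → ℂ
1/ k ! = fromℝ (fromℚ ((1ℤ ℚ./ (k !)) {{k ℕ.!≢0}}))

module _ {n : ℕ} where

  open RawSemiringDefs (RawRing.rawSemiring (Matrix-rawRing n)) using (sum; _^_)

  infixr 7 _·_

  _·_ : ℂ → Matrix n → Matrix n
  (z · M) a b = z ℂR.* M a b

  expPartialSum : Matrix n → ℕ → Matrix n
  expPartialSum M N = sum {N} (λ k → 1/ toℕ k ! · (M ^ toℕ k))

  -- E = e^M: the exponential series of M converges (entrywise) to E.
  IsExp : Matrix n → Matrix n → Set
  IsExp M E = ∀ a b → (λ N → expPartialSum M N a b) ⟶ E a b

record Graph (n : ℕ) : Set₁ where
  field
    Adj      : Rel (Fin n) 0ℓ
    adj?     : Decidable Adj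
    adj-sym  : Symmetric Adj
    loopless : Irreflexive _≡_ Adj

open Graph public

adjacencyMatrix : ∀ {n} → Graph n → Matrix n
adjacencyMatrix G a b = if does (adj? G a b) then ℂR.1# else ℂR.0#

-- U = e^{itA}.
IsTransition : ∀ {n} → Graph n → ℝ → Matrix n → Set
IsTransition G t U = IsExp ((i ℂR.* fromℝ t) · adjacencyMatrix G) U

-- The set { |U(t)_{u,u}| : t > 0 }.
ReturnModuli : ∀ {n} → Graph n → Fin n → Pred ℝ 0ℓ
ReturnModuli G u r =
  ∃[ t ] (0ℝ < t × ∃[ U ] (IsTransition G t U × IsModulus (U u u) r))

-- inf_{t>0} |U(t)_{u,u}| ≥ C, that is, C is a lower bound of the return moduli.
Sedentary : ∀ {n} → Graph n → Fin n → Set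
Sedentary G u =
  ∃[ C ] (0ℝ < C × C ≤ 1ℝ × (∀ r → r ∈ ReturnModuli G u → C ≤ r))

NotSedentary : ∀ {n} → Graph n → Fin n → Set
NotSedentary G u = IsInfimum (ReturnModuli G u) 0ℝ

private

  <⇒≱ : ∀ {x y} → x < y → ¬ (y ≤ x)
  <⇒≱ {x} {y} (ε , ε>0 , N , p) y≤x with (M , q) ← y≤x ε ε>0 =
    ℚ.<-asym (p (N ⊔ M) (ℕ.m≤m⊔n N M)) (q (N ⊔ M) (ℕ.m≤n⊔m N M))

  <0+⇒< : ∀ {x y} → x < 0ℝ + y → x < y
  <0+⇒< {x} {y} (ε , ε>0 , N , p) =
    ε , ε>0 , N , λ m m≥ → subst (seq x m ℚ.+ ε ℚ.<_) (ℚ.+-identityˡ (seq y m)) (p m m≥)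

-- Classically these are equivalent; constructively inf = 0 is the stronger assertion.
NotSedentary⇒¬Sedentary : ∀ {n} (G : Graph n) u → NotSedentary G u → ¬ Sedentary G u
NotSedentary⇒¬Sedentary G u (_ , approx) (C , C>0 , _ , C≤) =
  let (r , r∈S , r<C) = approx C C>0
  in <⇒≱ {r} {C} (<0+⇒< {r} {C} r<C) (C≤ r r∈S)

P : ∀ n → Graph n
P n = record
  { Adj      = λ a b → suc (toℕ a) ≡ toℕ b ⊎ suc (toℕ b) ≡ toℕ a
  ; adj?     = λ a b → (suc (toℕ a) ℕ.≟ toℕ b) ⊎-dec (suc (toℕ b) ℕ.≟ toℕ a)
  ; adj-sym  = swap
  ; loopless = λ { refl (inj₁ e) → ℕ.1+n≢n e ; refl (inj₂ e) → ℕ.1+n≢n e }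
  }

{-# OPTIONS --safe #-}

-- U(t)_{u,u} is real, because the path is bipartite; it equals Σ_k (-1)^k W_{2k} t^{2k}/(2k)!,
-- where W_{2k} counts the closed walks of length 2k at u. It is 1 at t = 0. At t = 2 it is
-- negative unless u is an end of P₃: thirteen terms of the series and a geometric tail suffice,
-- and these terms see only the part of the path within distance 6 of u, which leaves finitely
-- many cases. Bisection on the partial sums then yields rational t at which |U(t)_{u,u}| is as
-- small as desired. At an end of P₃ the amplitude (1 + cos √2t)/2 touches zero without changing
-- sign, but its value at 2s is the square of the amplitude cos √2s of the middle vertex at s.

module Submission where

open import Defs hiding (_+_; _*_; -_; _<_; _≤_; _≈_; i)
import Defs as Def

open import Algebra.Bundles using (module CommutativeRing)
open import Algebra.Bundles.Raw using (module RawRing)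
import Algebra.Definitions.RawSemiring as RawSemiringDefs
import Algebra.Properties.Semiring.Sum as SemiringSum
open import Data.Bool.Base using (Bool; true; false; T; _∨_; if_then_else_)
open import Data.Empty using (⊥-elim)
open import Data.Fin.Base using (Fin; zero; suc; toℕ; fromℕ<)
import Data.Fin.Properties as Fin
open import Data.Integer.Base as ℤ using (1ℤ; -[1+_])
import Data.Integer.Properties as ℤ
import Data.Integer.Solver as ℤSolver
open import Data.Nat.Base as ℕ using (ℕ; zero; suc; _!) renaming (_≥_ to _≥ℕ_)
import Data.Nat.Coprimality as ℕ
import Data.Nat.Properties as ℕ
open import Data.Product.Base using (_×_; _,_; ∃-syntax; proj₁; proj₂)
open import Data.Rational.Base as ℚ
  using ( ℚ; mkℚ; 0ℚ; 1ℚ; ½; _+_; _*_; -_; _-_; _<_; _≤_; *≤*; ∣_∣; 1/_; _⊓_; _⊔_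
        ; nonNegative; positive)
open import Data.Rational.Properties as ℚ using (module ≤-Reasoning)
open import Data.Rational.Solver using (module +-*-Solver)
import Data.Rational.Unnormalised.Base as ℚᵘ
import Data.Rational.Unnormalised.Properties as ℚᵘ
open import Data.Sum.Base using (_⊎_; inj₁; inj₂; [_,_]′)
open import Function.Base using (_∘_; id)
open import Relation.Binary.PropositionalEquality
  using (_≡_; refl; sym; trans; cong; cong₂; subst; subst₂; module ≡-Reasoning)
open import Relation.Nullary using (yes; no; Dec; does)
open import Relation.Nullary.Decidable using (from-yes; _⊎-dec_; _×-dec_)

open +-*-Solver using (solve; con; _:=_; _:+_; _:*_; _:-_; :-_)
open RawSemiringDefs ℚ.+-*-rawSemiring using (_^_)
open SemiringSum (CommutativeRing.semiring ℚ.+-*-commutativeRing)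
  using (sum; sum-cong-≗; ∑-distrib-+; *-distribˡ-sum)

-- Signs of reals cannot be decided, so no zero of the amplitude is sought; an infimum 0 only asks
-- for values below every positive ε. All decisions concern rational polynomials at rational times.
-- Bisection runs on a single partial sum, fixed before the time is known, and a tail estimate
-- uniform on [0, T] carries the small value over to all longer partial sums. Every estimate rests
-- on one bound: there are at most 2^k walks of length k. The series at t is thus dominated by that
-- of e^{2t}. At t = 2 this is e^4, and from the thirteenth power on each of its terms is at most
-- half the preceding one. A real is a sequence of rationals, so the sequence of partial sums serves
-- as the limit itself, and statements about U(t) become statements about partial sums. The double
-- angle identity is likewise proved without trigonometric functions: it holds coefficient by
-- coefficient, and an error bound for Cauchy products passes it on to partial sums.

-- Order and absolute value on the rationals

0≤1 : 0ℚ ≤ 1ℚ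
0≤1 = ℚ.nonNegative⁻¹ 1ℚ

0≤½ : 0ℚ ≤ ½
0≤½ = ℚ.nonNegative⁻¹ ½

0<½ : 0ℚ < ½
0<½ = ℚ.positive⁻¹ ½

-- The equation says s - r = q - p. A linear inequality is thereby reduced to a known one and an
-- identity for the ring solver.
≤-transfer : ∀ {p q r s} → p ≤ q → r + q ≡ s + p → r ≤ s
≤-transfer {p} {q} {r} {s} p≤q eq = subst₂ _≤_
  (trans (cong (_- q) (sym eq)) (solve 2 (λ r q → (r :+ q) :- q := r) refl r q))
  (solve 2 (λ s q → (s :+ q) :- q := s) refl s q)
  (ℚ.+-monoˡ-≤ (- q) (ℚ.+-monoʳ-≤ s p≤q))

*-monoʳ : ∀ {p q} r → 0ℚ ≤ r → p ≤ q → r * p ≤ r * q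
*-monoʳ r r≥0 = ℚ.*-monoˡ-≤-nonNeg r {{nonNegative r≥0}}

*-monoˡ : ∀ {p q} r → 0ℚ ≤ r → p ≤ q → p * r ≤ q * r
*-monoˡ r r≥0 = ℚ.*-monoʳ-≤-nonNeg r {{nonNegative r≥0}}

*-mono : ∀ {p q r s} → 0ℚ ≤ p → 0ℚ ≤ s → p ≤ q → r ≤ s → p * r ≤ q * s
*-mono {p} {q} {r} {s} p≥0 s≥0 p≤q r≤s = ℚ.≤-trans (*-monoʳ p p≥0 r≤s) (*-monoˡ s s≥0 p≤q)

*-nonNeg : ∀ {p q} → 0ℚ ≤ p → 0ℚ ≤ q → 0ℚ ≤ p * q
*-nonNeg {p} {q} p≥0 q≥0 = subst (_≤ p * q) (ℚ.*-zeroʳ p) (*-monoʳ p p≥0 q≥0)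

+-nonNeg : ∀ {p q} → 0ℚ ≤ p → 0ℚ ≤ q → 0ℚ ≤ p + q
+-nonNeg = ℚ.+-mono-≤

*-pos : ∀ {p q} → 0ℚ < p → 0ℚ < q → 0ℚ < p * q
*-pos {p} {q} p>0 q>0 = subst (_< p * q) (ℚ.*-zeroʳ p) (ℚ.*-monoʳ-<-pos p {{positive p>0}} q>0)

*-mono-∣∣ : ∀ {p q a b} → ∣ p ∣ ≤ a → ∣ q ∣ ≤ b → ∣ p * q ∣ ≤ a * b
*-mono-∣∣ {p} {q} {a} {b} p≤ q≤ = subst (_≤ a * b) (sym (ℚ.∣p*q∣≡∣p∣*∣q∣ p q))
  (*-mono (ℚ.0≤∣p∣ p) (ℚ.≤-trans (ℚ.0≤∣p∣ q) q≤) p≤ q≤)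

+-mono-∣∣ : ∀ {p q a b} → ∣ p ∣ ≤ a → ∣ q ∣ ≤ b → ∣ p + q ∣ ≤ a + b
+-mono-∣∣ {p} {q} p≤ q≤ = ℚ.≤-trans (ℚ.∣p+q∣≤∣p∣+∣q∣ p q) (ℚ.+-mono-≤ p≤ q≤)

∣-∣-swap : ∀ p q → ∣ p - q ∣ ≡ ∣ q - p ∣
∣-∣-swap p q = trans (cong ∣_∣ (solve 2 (λ p q → p :- q := :- (q :- p)) refl p q)) (ℚ.∣-p∣≡∣p∣ (q - p))

p≤∣p∣ : ∀ p → p ≤ ∣ p ∣
p≤∣p∣ p with ℚ.≤-total 0ℚ p
... | inj₁ 0≤p = ℚ.≤-reflexive (sym (ℚ.0≤p⇒∣p∣≡p 0≤p))
... | inj₂ p≤0 = ℚ.≤-trans p≤0 (ℚ.0≤∣p∣ p)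

∣p∣≤ : ∀ {p q} → p ≤ q → - q ≤ p → ∣ p ∣ ≤ q
∣p∣≤ {p} {q} p≤q -q≤p with ℚ.∣p∣≡p∨∣p∣≡-p p
... | inj₁ e = subst (_≤ q) (sym e) p≤q
... | inj₂ e = subst (_≤ q) (sym e) (≤-transfer -q≤p (solve 2 (λ p q → :- p :+ p := q :+ :- q) refl p q))

-- mkℚ instead of _/_, which would normalise by a gcd.
⟦_⟧ : ℕ → ℚ
⟦ n ⟧ = mkℚ (ℤ.+ n) 0 (ℕ.sym (ℕ.1-coprimeTo n))

⟦⟧-suc : ∀ n → ⟦ suc n ⟧ ≡ ⟦ n ⟧ + 1ℚ
⟦⟧-suc n = ℚ.toℚᵘ-injective (ℚᵘ.≃-trans
  (ℚᵘ.*≡* (cong (ℤ._* (ℤ.+ 1)) (solveℤ 1 (λ n → conℤ (ℤ.+ 1) :+ℤ n :=ℤ n :*ℤ conℤ (ℤ.+ 1) :+ℤ conℤ (ℤ.+ 1) :*ℤ conℤ (ℤ.+ 1)) refl (ℤ.+ n))))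
  (ℚᵘ.≃-sym (ℚ.toℚᵘ-homo-+ ⟦ n ⟧ 1ℚ)))
  where open ℤSolver.+-*-Solver using () renaming (solve to solveℤ; con to conℤ; _:+_ to _:+ℤ_; _:*_ to _:*ℤ_; _:=_ to _:=ℤ_)

⟦⟧-* : ∀ m n → ⟦ m ℕ.* n ⟧ ≡ ⟦ m ⟧ * ⟦ n ⟧
⟦⟧-* m n = ℚ.toℚᵘ-injective (ℚᵘ.≃-trans
  (ℚᵘ.*≡* (cong (ℤ._* (ℤ.+ 1)) (ℤ.pos-* m n)))
  (ℚᵘ.≃-sym (ℚ.toℚᵘ-homo-* ⟦ m ⟧ ⟦ n ⟧)))

⟦⟧-mono : ∀ {m n} → m ℕ.≤ n → ⟦ m ⟧ ≤ ⟦ n ⟧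
⟦⟧-mono m≤n = *≤* (ℤ.*-monoʳ-≤-nonNeg (ℤ.+ 1) (ℤ.+≤+ m≤n))

archimedean : ∀ q → ∃[ n ] q ≤ ⟦ n ⟧
archimedean (mkℚ (ℤ.+ n) d _) = n , *≤* (ℤ.*-monoˡ-≤-nonNeg (ℤ.+ n) (ℤ.+≤+ (ℕ.s≤s ℕ.z≤n)))
archimedean (mkℚ -[1+ n ] d _) = 0 , *≤* ℤ.-≤+

recip : ℕ → ℚ
recip k = 1/ ⟦ suc k ⟧

recip-inverse : ∀ k → ⟦ suc k ⟧ * recip k ≡ 1ℚ
recip-inverse k = ℚ.*-inverseʳ ⟦ suc k ⟧

recip≥0 : ∀ k → 0ℚ ≤ recip k
recip≥0 k = ℚ.nonNegative⁻¹ (recip k)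

-- Powers of ½ and geometric tails

½^-nonNeg : ∀ k → 0ℚ ≤ ½ ^ k
½^-nonNeg zero    = 0≤1
½^-nonNeg (suc k) = *-nonNeg 0≤½ (½^-nonNeg k)

½^-antitone : ∀ {m n} → m ℕ.≤′ n → ½ ^ n ≤ ½ ^ m
½^-antitone ℕ.≤′-refl = ℚ.≤-refl
½^-antitone {m} {suc n} (ℕ.≤′-step m≤n) = ℚ.≤-trans
  (≤-transfer (*-nonNeg 0≤½ (½^-nonNeg n))
    (solve 1 (λ h → con ½ :* h :+ con ½ :* h := h :+ con 0ℚ) refl (½ ^ n)))
  (½^-antitone m≤n)

½^≤1 : ∀ k → ½ ^ k ≤ 1ℚ
½^≤1 k = ½^-antitone {0} {k} ℕ.z≤′n

-- This is n ≤ 2^n: the quantity at n + 1 is the mean of the one at n and of ½^n, both at most 1.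
⟦n⟧½^n≤1 : ∀ n → ⟦ n ⟧ * ½ ^ n ≤ 1ℚ
⟦n⟧½^n≤1 zero    = from-yes (⟦ 0 ⟧ * ½ ^ 0 ℚ.≤? 1ℚ)
⟦n⟧½^n≤1 (suc n) = ≤-transfer
  (ℚ.+-mono-≤ (*-monoʳ ½ 0≤½ (⟦n⟧½^n≤1 n)) (*-monoʳ ½ 0≤½ (½^≤1 n)))
  (trans (cong (λ m → m * (½ * ½ ^ n) + (½ * 1ℚ + ½ * 1ℚ)) (⟦⟧-suc n))
    (solve 2 (λ m h → (m :+ con 1ℚ) :* (con ½ :* h) :+ (con ½ :* con 1ℚ :+ con ½ :* con 1ℚ)
                    := con 1ℚ :+ (con ½ :* (m :* h) :+ con ½ :* h)) refl ⟦ n ⟧ (½ ^ n)))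

½^-null : ∀ D {ε} → 0ℚ ≤ D → 0ℚ < ε → ∃[ N ] (∀ n → N ℕ.≤ n → D * ½ ^ n ≤ ε)
½^-null D {ε} D≥0 ε>0 = N , λ n N≤n → begin
    D * ½ ^ n
      ≤⟨ *-monoʳ D D≥0 (½^-antitone {N} {n} (ℕ.≤⇒≤′ N≤n)) ⟩
    D * ½ ^ N
      ≡⟨ cong (_* ½ ^ N) D≡ ⟩
    ε * (D * 1/ε) * ½ ^ N
      ≤⟨ *-monoˡ (½ ^ N) (½^-nonNeg N) (*-monoʳ ε ε≥0 (proj₂ (archimedean (D * 1/ε)))) ⟩
    ε * ⟦ N ⟧ * ½ ^ N
      ≡⟨ ℚ.*-assoc ε ⟦ N ⟧ (½ ^ N) ⟩
    ε * (⟦ N ⟧ * ½ ^ N)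
      ≤⟨ *-monoʳ ε ε≥0 (⟦n⟧½^n≤1 N) ⟩
    ε * 1ℚ
      ≡⟨ ℚ.*-identityʳ ε ⟩
    ε ∎
  where
  open ≤-Reasoning
  instance
    ε≢0 = ℚ.pos⇒nonZero ε {{positive ε>0}}
  1/ε = 1/ ε
  ε≥0 = ℚ.<⇒≤ ε>0
  N = proj₁ (archimedean (D * 1/ε))
  D≡ : D ≡ ε * (D * 1/ε)
  D≡ = trans (sym (ℚ.*-identityʳ D)) (trans (cong (D *_) (sym (ℚ.*-inverseʳ ε)))
    (solve 3 (λ D e f → D :* (e :* f) := e :* (D :* f)) refl D ε 1/ε))

Σ< : (ℕ → ℚ) → ℕ → ℚ
Σ< a zero    = 0ℚ
Σ< a (suc n) = Σ< a n + a n

Geometric : ℕ → ℚ → (ℕ → ℚ) → Set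
Geometric m C a = ∀ k → m ℕ.≤ k → ∣ a k ∣ ≤ C * ½ ^ k

-- The bound for what is still to come stands on the left so that the induction closes: a new term
-- costs at most C ½^k, exactly the amount by which 2C ½^k drops when halved.
tail-step : ∀ {m C a} → Geometric m C a → ∀ n → m ℕ.≤ n → ∀ j →
  ∣ Σ< a (j ℕ.+ n) - Σ< a n ∣ + (C + C) * ½ ^ (j ℕ.+ n) ≤ (C + C) * ½ ^ n
tail-step {C = C} {a} geo n m≤n zero = ℚ.≤-reflexive
  (trans (cong (λ z → ∣ z ∣ + (C + C) * ½ ^ n) (ℚ.+-inverseʳ (Σ< a n))) (ℚ.+-identityˡ _))
tail-step {C = C} {a} geo n m≤n (suc j) = begin
  ∣ S + x - S₀ ∣ + (C + C) * (½ * h)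
    ≡⟨ cong (λ z → ∣ z ∣ + (C + C) * (½ * h))
         (solve 3 (λ S x S₀ → S :+ x :- S₀ := (S :- S₀) :+ x) refl S x S₀) ⟩
  ∣ (S - S₀) + x ∣ + (C + C) * (½ * h)
    ≤⟨ ℚ.+-monoˡ-≤ ((C + C) * (½ * h))
         (+-mono-∣∣ {S - S₀} {x} ℚ.≤-refl (geo (j ℕ.+ n) (ℕ.≤-trans m≤n (ℕ.m≤n+m n j)))) ⟩
  ∣ S - S₀ ∣ + C * h + (C + C) * (½ * h)
    ≡⟨ solve 3 (λ d C h → d :+ C :* h :+ (C :+ C) :* (con ½ :* h) := d :+ (C :+ C) :* h)
         refl ∣ S - S₀ ∣ C h ⟩
  ∣ S - S₀ ∣ + (C + C) * h
    ≤⟨ tail-step {C = C} geo n m≤n j ⟩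
  (C + C) * ½ ^ n ∎
  where
  open ≤-Reasoning
  S = Σ< a (j ℕ.+ n)
  S₀ = Σ< a n
  x = a (j ℕ.+ n)
  h = ½ ^ (j ℕ.+ n)

tail-bound : ∀ {m C a} → 0ℚ ≤ C → Geometric m C a → ∀ {n N} → m ℕ.≤ n → n ℕ.≤ N →
  ∣ Σ< a N - Σ< a n ∣ ≤ (C + C) * ½ ^ n
tail-bound {m} {C} {a} C≥0 geo {n} {N} m≤n n≤N = ℚ.≤-trans
  (≤-transfer (*-nonNeg (+-nonNeg C≥0 C≥0) (½^-nonNeg N))
    (solve 2 (λ d c → d :+ c := (d :+ c) :+ con 0ℚ) refl ∣ Σ< a N - Σ< a n ∣ _))
  (subst (λ K → ∣ Σ< a K - Σ< a n ∣ + (C + C) * ½ ^ K ≤ (C + C) * ½ ^ n)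
    (ℕ.m∸n+n≡m n≤N) (tail-step {C = C} geo n m≤n (N ℕ.∸ n)))

-- The terms t^k/k! of the exponential series

ex : ℚ → ℕ → ℚ
ex t zero    = 1ℚ
ex t (suc k) = ex t k * t * recip k

ex-suc : ∀ t k → ⟦ suc k ⟧ * ex t (suc k) ≡ ex t k * t
ex-suc t k = begin
  ⟦ suc k ⟧ * (ex t k * t * recip k)
    ≡⟨ solve 3 (λ n e r → n :* (e :* r) := e :* (n :* r)) refl ⟦ suc k ⟧ (ex t k * t) (recip k) ⟩
  ex t k * t * (⟦ suc k ⟧ * recip k)
    ≡⟨ cong (ex t k * t *_) (recip-inverse k) ⟩
  ex t k * t * 1ℚ
    ≡⟨ ℚ.*-identityʳ (ex t k * t) ⟩
  ex t k * t ∎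
  where open ≡-Reasoning

ex≥0 : ∀ {t} → 0ℚ ≤ t → ∀ k → 0ℚ ≤ ex t k
ex≥0 t≥0 zero    = 0≤1
ex≥0 t≥0 (suc k) = *-nonNeg (*-nonNeg (ex≥0 t≥0 k) t≥0) (recip≥0 k)

ex-mono : ∀ {s t} → 0ℚ ≤ s → s ≤ t → ∀ k → ex s k ≤ ex t k
ex-mono s≥0 s≤t zero    = ℚ.≤-refl
ex-mono s≥0 s≤t (suc k) = *-monoˡ (recip k) (recip≥0 k)
  (*-mono (ex≥0 s≥0 k) (ℚ.≤-trans s≥0 s≤t) (ex-mono s≥0 s≤t k) s≤t)

ex-* : ∀ s t k → ex (s * t) k ≡ s ^ k * ex t k
ex-* s t zero    = refl
ex-* s t (suc k) = trans (cong (λ e → e * (s * t) * recip k) (ex-* s t k))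
  (solve 5 (λ p e s t r → p :* e :* (s :* t) :* r := s :* p :* (e :* t :* r)) refl
    (s ^ k) (ex t k) s t (recip k))

ex-0 : ∀ k → ex 0ℚ (suc k) ≡ 0ℚ
ex-0 k = trans (cong (_* recip k) (ℚ.*-zeroʳ (ex 0ℚ k))) (ℚ.*-zeroˡ (recip k))

initial-bound : ∀ (a : ℕ → ℚ) n → ∃[ C ] (∀ k → k ℕ.≤ n → a k ≤ C)
initial-bound a zero    = a 0 , λ { _ ℕ.z≤n → ℚ.≤-refl }
initial-bound a (suc n) with (C , a≤C) ← initial-bound a n = C ⊔ a (suc n) , λ k k≤ →
  [ (λ k<   → ℚ.≤-trans (a≤C k (ℕ.s≤s⁻¹ k<)) (ℚ.p≤p⊔q C (a (suc n))))
  , (λ { refl → ℚ.p≤q⊔p C (a (suc n)) })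
  ]′ (ℕ.m≤n⇒m<n∨m≡n k≤)

antitone-bound : ∀ (a : ℕ → ℚ) n → (∀ k → n ℕ.≤ k → a (suc k) ≤ a k) → ∃[ C ] (∀ k → a k ≤ C)
antitone-bound a n anti with (C , a≤C) ← initial-bound a n = C , bound
  where
  bound : ∀ k → a k ≤ C
  bound k with ℕ.≤-total k n
  ... | inj₁ k≤n = a≤C k k≤n
  ... | inj₂ n≤k = later (ℕ.≤⇒≤′ n≤k)
    where
    later : ∀ {k} → n ℕ.≤′ k → a k ≤ C
    later ℕ.≤′-refl = a≤C n ℕ.≤-refl
    later {suc k} (ℕ.≤′-step n≤k) = ℚ.≤-trans (anti k (ℕ.≤′⇒≤ n≤k)) (later n≤k)

-- Once k is at least some n ≥ t, the ratio t/(k+1) of successive terms is at most 1.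
ex-bounded : ∀ {t} → 0ℚ ≤ t → ∃[ C ] (∀ k → ex t k ≤ C)
ex-bounded {t} t≥0 with (n , t≤n) ← archimedean t = antitone-bound (ex t) n λ k n≤k → begin
    ex t k * t * recip k
      ≡⟨ ℚ.*-assoc (ex t k) t (recip k) ⟩
    ex t k * (t * recip k)
      ≤⟨ *-monoʳ (ex t k) (ex≥0 t≥0 k) (*-monoˡ (recip k) (recip≥0 k)
           (ℚ.≤-trans t≤n (⟦⟧-mono (ℕ.m≤n⇒m≤1+n n≤k)))) ⟩
    ex t k * (⟦ suc k ⟧ * recip k)
      ≡⟨ cong (ex t k *_) (recip-inverse k) ⟩
    ex t k * 1ℚ
      ≡⟨ ℚ.*-identityʳ (ex t k) ⟩
    ex t k ∎
  where open ≤-Reasoning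

opaque

  2ℚ : ℚ
  2ℚ = ⟦ 2 ⟧

  2ℚ≡⟦2⟧ : 2ℚ ≡ ⟦ 2 ⟧
  2ℚ≡⟦2⟧ = refl

  2ℚ≡1+1 : 2ℚ ≡ 1ℚ + 1ℚ
  2ℚ≡1+1 = refl

  0≤2 : 0ℚ ≤ 2ℚ
  0≤2 = ℚ.nonNegative⁻¹ 2ℚ

  ½*2≡1 : ½ * 2ℚ ≡ 1ℚ
  ½*2≡1 = refl

double≥0 : ∀ t → 0ℚ ≤ t → 0ℚ ≤ 2ℚ * t
double≥0 t = *-nonNeg {2ℚ} {t} 0≤2

½*2*t≡t : ∀ t → ½ * (2ℚ * t) ≡ t
½*2*t≡t t = trans (sym (ℚ.*-assoc ½ 2ℚ t)) (trans (cong (_* t) ½*2≡1) (ℚ.*-identityˡ t))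

-- Mere boundedness at time 2t thus yields geometric decay at time t; doubling once more yields the
-- rate ¼^k.
ex-halve : ∀ t k → ex t k ≡ ex (2ℚ * t) k * ½ ^ k
ex-halve t k = begin
  ex t k                   ≡⟨ cong (λ s → ex s k) (½*2*t≡t t) ⟨
  ex (½ * (2ℚ * t)) k      ≡⟨ ex-* ½ (2ℚ * t) k ⟩
  ½ ^ k * ex (2ℚ * t) k    ≡⟨ ℚ.*-comm (½ ^ k) (ex (2ℚ * t) k) ⟩
  ex (2ℚ * t) k * ½ ^ k    ∎
  where open ≡-Reasoning

ex-geometric : ∀ {t} → 0ℚ ≤ t → ∃[ C ] (0ℚ ≤ C × (∀ k → ex t k ≤ C * ½ ^ k))
ex-geometric {t} t≥0 = let (C , e≤C) = ex-bounded {2ℚ * t} (double≥0 t t≥0) in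
  C , ℚ.≤-trans 0≤1 (e≤C 0) , λ k → subst (_≤ C * ½ ^ k) (sym (ex-halve t k))
    (*-monoˡ {ex (2ℚ * t) k} {C} (½ ^ k) (½^-nonNeg k) (e≤C k))

-- Meant for the Cauchy product, where one factor ½^k is used up against the tails of the other
-- series and the second keeps the sum finite.
ex-geometric² : ∀ {t} → 0ℚ ≤ t → ∃[ C ] (0ℚ ≤ C × (∀ k → ex t k ≤ C * (½ ^ k * ½ ^ k)))
ex-geometric² {t} t≥0 = let (C , C≥0 , e≤C) = ex-geometric {2ℚ * t} (double≥0 t t≥0) in
  C , C≥0 , λ k → subst₂ _≤_ (sym (ex-halve t k)) (ℚ.*-assoc C (½ ^ k) (½ ^ k))
    (*-monoˡ {ex (2ℚ * t) k} {C * ½ ^ k} (½ ^ k) (½^-nonNeg k) (e≤C k))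

-- Exponential generating series with coefficients bounded by 2^k

term : (ℕ → ℚ) → ℚ → ℕ → ℚ
term c t k = c k * ex t k

series : (ℕ → ℚ) → ℚ → ℕ → ℚ
series c t = Σ< (term c t)

Tame : (ℕ → ℚ) → Set
Tame c = ∀ k → ∣ c k ∣ ≤ 2ℚ ^ k

term-bound : ∀ {c} → Tame c → ∀ {t T} → 0ℚ ≤ t → t ≤ T → ∀ k → ∣ term c t k ∣ ≤ ex (2ℚ * T) k
term-bound {c} tame {t} {T} t≥0 t≤T k = subst (∣ term c t k ∣ ≤_) (sym (ex-* 2ℚ T k))
  (*-mono-∣∣ {c k} {ex t k} (tame k)
    (subst (_≤ ex T k) (sym (ℚ.0≤p⇒∣p∣≡p (ex≥0 t≥0 k))) (ex-mono t≥0 t≤T k)))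

term-geometric : ∀ {c} → Tame c → ∀ {T} → 0ℚ ≤ T →
  ∃[ C ] (0ℚ ≤ C × (∀ {t} → 0ℚ ≤ t → t ≤ T → Geometric 0 C (term c t)))
term-geometric {c} tame {T} T≥0 = let (C , C≥0 , e≤) = ex-geometric {2ℚ * T} (double≥0 T T≥0) in
  C , C≥0 , λ {t} t≥0 t≤T k _ → ℚ.≤-trans (term-bound {c} tame {t} {T} t≥0 t≤T k) (e≤ k)

-- The index depends on T and η only, so it can be fixed before bisection produces the time t.
series-uniform : ∀ {c} → Tame c → ∀ {T η} → 0ℚ ≤ T → 0ℚ < η →
  ∃[ N ] (∀ {t} → 0ℚ ≤ t → t ≤ T → ∀ {m n} → N ℕ.≤ m → m ℕ.≤ n →
    ∣ series c t n - series c t m ∣ ≤ η)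
series-uniform {c} tame {T} {η} T≥0 η>0 =
  let (C , C≥0 , geo) = term-geometric {c} tame {T} T≥0
      (N , small) = ½^-null (C + C) {η} (+-nonNeg {C} {C} C≥0 C≥0) η>0
  in N , λ {t} t≥0 t≤T {m} {n} N≤m m≤n → ℚ.≤-trans
    (tail-bound {0} {C} {term c t} C≥0 (geo t≥0 t≤T) {m} {n} ℕ.z≤n m≤n) (small m N≤m)

-- Lipschitz functions and bisection

module _ (T : ℚ) where

  infix 4 _∈[0,T]
  _∈[0,T] : ℚ → Set
  t ∈[0,T] = 0ℚ ≤ t × t ≤ T

  -- The bound is recorded beside the slope because the slope of a product involves the bounds of
  -- its factors.
  record Lipschitz (f : ℚ → ℚ) : Set where
    constructor lipschitz
    field
      {bound slope} : ℚ
      slope≥0 : 0ℚ ≤ slope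
      bounded : ∀ {t} → t ∈[0,T] → ∣ f t ∣ ≤ bound
      slopes  : ∀ {s t} → s ∈[0,T] → t ∈[0,T] → ∣ f s - f t ∣ ≤ slope * ∣ s - t ∣

  const-lipschitz : ∀ q → Lipschitz (λ _ → q)
  const-lipschitz q = lipschitz {bound = ∣ q ∣} {0ℚ} ℚ.≤-refl (λ _ → ℚ.≤-refl) λ {s} {t} _ _ →
    ℚ.≤-reflexive (trans (cong ∣_∣ (ℚ.+-inverseʳ q)) (sym (ℚ.*-zeroˡ ∣ s - t ∣)))

  id-lipschitz : Lipschitz (λ t → t)
  id-lipschitz = lipschitz {bound = T} {1ℚ} 0≤1
    (λ (t≥0 , t≤T) → subst (_≤ T) (sym (ℚ.0≤p⇒∣p∣≡p t≥0)) t≤T)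
    λ {s} {t} _ _ → ℚ.≤-reflexive (sym (ℚ.*-identityˡ ∣ s - t ∣))

  +-lipschitz : ∀ {f g} → Lipschitz f → Lipschitz g → Lipschitz (λ t → f t + g t)
  +-lipschitz {f} {g} (lipschitz {B} {L} L≥0 f≤ f-) (lipschitz {C} {M} M≥0 g≤ g-) =
    lipschitz {bound = B + C} {L + M} (+-nonNeg L≥0 M≥0)
      (λ {t} t∈ → +-mono-∣∣ {f t} {g t} (f≤ t∈) (g≤ t∈))
      λ {s} {t} s∈ t∈ → subst₂ _≤_
        (cong ∣_∣ (solve 4 (λ a b c d → (a :- b) :+ (c :- d) := (a :+ c) :- (b :+ d)) refl (f s) (f t) (g s) (g t)))
        (sym (ℚ.*-distribʳ-+ ∣ s - t ∣ L M))
        (+-mono-∣∣ {f s - f t} {g s - g t} (f- s∈ t∈) (g- s∈ t∈))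

  *-lipschitz : ∀ {f g} → 0ℚ ≤ T → Lipschitz f → Lipschitz g → Lipschitz (λ t → f t * g t)
  *-lipschitz {f} {g} T≥0 (lipschitz {B} {L} L≥0 f≤ f-) (lipschitz {C} {M} M≥0 g≤ g-) =
    lipschitz {bound = B * C} {B * M + C * L}
      (+-nonNeg (*-nonNeg (ℚ.≤-trans (ℚ.0≤∣p∣ (f 0ℚ)) (f≤ 0∈)) M≥0)
                (*-nonNeg (ℚ.≤-trans (ℚ.0≤∣p∣ (g 0ℚ)) (g≤ 0∈)) L≥0))
      (λ {t} t∈ → *-mono-∣∣ {f t} {g t} (f≤ t∈) (g≤ t∈))
      λ {s} {t} s∈ t∈ → subst₂ _≤_
        (cong ∣_∣ (solve 4 (λ a b c d → a :* (c :- d) :+ d :* (a :- b) := a :* c :- b :* d) refl (f s) (f t) (g s) (g t)))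
        (solve 5 (λ B M C L d → B :* (M :* d) :+ C :* (L :* d) := (B :* M :+ C :* L) :* d) refl B M C L ∣ s - t ∣)
        (+-mono-∣∣ {f s * (g s - g t)} {g t * (f s - f t)}
          (*-mono-∣∣ {f s} {g s - g t} (f≤ s∈) (g- s∈ t∈))
          (*-mono-∣∣ {g t} {f s - f t} (g≤ t∈) (f- s∈ t∈)))
    where
    0∈ : 0ℚ ∈[0,T]
    0∈ = ℚ.≤-refl , T≥0

  series-lipschitz : ∀ c → 0ℚ ≤ T → ∀ n → Lipschitz (λ t → series c t n)
  series-lipschitz c T≥0 zero    = const-lipschitz 0ℚ
  series-lipschitz c T≥0 (suc n) =
    +-lipschitz (series-lipschitz c T≥0 n) (*-lipschitz T≥0 (const-lipschitz (c n)) (ex-lipschitz n))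
    where
    ex-lipschitz : ∀ k → Lipschitz (λ t → ex t k)
    ex-lipschitz zero    = const-lipschitz 1ℚ
    ex-lipschitz (suc k) =
      *-lipschitz T≥0 (*-lipschitz T≥0 (ex-lipschitz k) id-lipschitz) (const-lipschitz (recip k))

  Bracket : (ℚ → ℚ) → ℚ → ℚ → Set
  Bracket p η gap = ∃[ a ] ∃[ b ] (a ∈[0,T] × b ∈[0,T] × b - a ≡ gap × η ≤ p a × p b < η)

  midpoint-∈ : ∀ {a b} → a ∈[0,T] → b ∈[0,T] → ½ * (a + b) ∈[0,T]
  midpoint-∈ {a} {b} (a≥0 , a≤T) (b≥0 , b≤T) =
    *-nonNeg {½} {a + b} 0≤½ (+-nonNeg {a} {b} a≥0 b≥0) ,
    ≤-transfer (*-monoʳ ½ 0≤½ (ℚ.+-mono-≤ a≤T b≤T))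
      (solve 2 (λ m T → m :+ con ½ :* (T :+ T) := T :+ m) refl (½ * (a + b)) T)

  halve-bracket : ∀ {p η gap} → Bracket p η gap → Bracket p η (½ * gap)
  halve-bracket {p} {η} {gap} (a , b , a∈ , b∈ , eq , pa≥ , pb<) with η ℚ.≤? p (½ * (a + b))
  ... | yes pm≥ = ½ * (a + b) , b , midpoint-∈ a∈ b∈ , b∈ ,
        trans (solve 2 (λ a b → b :- con ½ :* (a :+ b) := con ½ :* (b :- a)) refl a b) (cong (½ *_) eq) ,
        pm≥ , pb<
  ... | no pm≱ = a , ½ * (a + b) , a∈ , midpoint-∈ a∈ b∈ ,
        trans (solve 2 (λ a b → con ½ :* (a :+ b) :- a := con ½ :* (b :- a)) refl a b) (cong (½ *_) eq) ,
        pa≥ , ℚ.≰⇒> pm≱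

  bisect : ∀ {p η} → 0ℚ ≤ T → η ≤ p 0ℚ → p T < η → ∀ k → Bracket p η (½ ^ k * T)
  bisect T≥0 p0≥ pT< zero =
    0ℚ , T , (ℚ.≤-refl , T≥0) , (T≥0 , ℚ.≤-refl) ,
    solve 1 (λ T → T :- con 0ℚ := con 1ℚ :* T) refl T , p0≥ , pT<
  bisect {p} {η} T≥0 p0≥ pT< (suc k) = subst (Bracket p η) (sym (ℚ.*-assoc ½ (½ ^ k) T))
    (halve-bracket {p} {η} {½ ^ k * T} (bisect {p} {η} T≥0 p0≥ pT< k))

  -- The right end b of a fine bracket serves: p b < η, while p a ≥ η and p a - p b ≤ η give p b ≥
  -- 0. Crossing the level η instead of 0 also forces b > 0, since p is at least η at 0.
  small-value : ∀ {p η} → 0ℚ < η → 0ℚ ≤ T → Lipschitz p → η ≤ p 0ℚ → p T < η →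
    ∃[ t ] (0ℚ < t × t ≤ T × ∣ p t ∣ ≤ η)
  small-value {p} {η} η>0 T≥0 (lipschitz {slope = L} L≥0 _ p-) p0≥ pT< =
    let (k , small) = ½^-null (L * T) {η} (*-nonNeg {L} {T} L≥0 T≥0) η>0
    in at-bracket k (small k ℕ.≤-refl) (bisect {p} {η} T≥0 p0≥ pT< k)
    where
    at-bracket : ∀ k → L * T * ½ ^ k ≤ η → Bracket p η (½ ^ k * T) →
      ∃[ t ] (0ℚ < t × t ≤ T × ∣ p t ∣ ≤ η)
    at-bracket k small (a , b , a∈ , b∈@(b≥0 , b≤T) , gap , pa≥ , pb<) =
      b , b>0 , b≤T , ∣p∣≤ (ℚ.<⇒≤ pb<) (ℚ.≤-trans
        (≤-transfer (ℚ.<⇒≤ η>0) (solve 1 (λ η → :- η :+ η := con 0ℚ :+ con 0ℚ) refl η))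
        (≤-transfer (ℚ.+-mono-≤ pa≥ close)
          (solve 3 (λ η a b → con 0ℚ :+ (a :+ η) := b :+ (η :+ (a :- b))) refl η (p a) (p b))))
      where
      open ≤-Reasoning
      close : p a - p b ≤ η
      close = begin
        p a - p b         ≤⟨ p≤∣p∣ (p a - p b) ⟩
        ∣ p a - p b ∣     ≤⟨ p- a∈ b∈ ⟩
        L * ∣ a - b ∣     ≡⟨ cong (L *_) (trans (∣-∣-swap a b) (trans (cong ∣_∣ gap)
                               (ℚ.0≤p⇒∣p∣≡p (*-nonNeg {½ ^ k} {T} (½^-nonNeg k) T≥0)))) ⟩
        L * (½ ^ k * T)   ≡⟨ solve 3 (λ L h T → L :* (h :* T) := L :* T :* h) refl L (½ ^ k) T ⟩
        L * T * ½ ^ k     ≤⟨ small ⟩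
        η                 ∎
      b>0 : 0ℚ < b
      b>0 with 0ℚ ℚ.<? b
      ... | yes b>0 = b>0
      ... | no b≯0 = ⊥-elim (ℚ.<-irrefl refl (ℚ.<-≤-trans pb<
        (subst (λ t → η ≤ p t) (ℚ.≤-antisym b≥0 (ℚ.≮⇒≥ b≯0)) p0≥)))

-- From a sign change to arbitrarily small values

Vanishing : (ℕ → ℚ) → Set
Vanishing c = ∀ η → 0ℚ < η → ∃[ t ] (0ℚ < t × ∃[ N ] (∀ n → N ℕ.≤ n → ∣ series c t n ∣ ≤ η))

series-at-0 : ∀ c n → series c 0ℚ (suc n) ≡ c 0
series-at-0 c zero    = solve 1 (λ c → con 0ℚ :+ c :* con 1ℚ := c) refl (c 0)
series-at-0 c (suc n) = trans (cong₂ _+_ (series-at-0 c n) (trans (cong (c (suc n) *_) (ex-0 n)) (ℚ.*-zeroʳ (c (suc n)))))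
  (ℚ.+-identityʳ (c 0))

crossing-within : ∀ {c} → Tame c → c 0 ≡ 1ℚ → ∀ {T m} → 0ℚ ≤ T →
  (∀ n → m ℕ.≤ n → series c T n ≤ 0ℚ) → ∀ {δ} → 0ℚ < δ → δ ≤ 1ℚ →
  ∃[ t ] (0ℚ < t × ∃[ N ] (∀ n → N ℕ.≤ n → ∣ series c t n ∣ ≤ δ + δ))
crossing-within {c} tame c0≡1 {T} {m} T≥0 neg {δ} δ>0 δ≤1 =
  let (N , near) = series-uniform {c} tame {T} {δ} T≥0 δ>0
      -- The successor makes the partial sum contain its constant term, so that its value at 0 is 1.
      M = suc (m ℕ.⊔ N)
      (t , t>0 , t≤T , small) = small-value T {λ t → series c t M} {δ} δ>0 T≥0
        (series-lipschitz T c T≥0 M)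
        (ℚ.≤-trans δ≤1 (ℚ.≤-reflexive (sym (trans (series-at-0 c (m ℕ.⊔ N)) c0≡1))))
        (ℚ.≤-<-trans (neg M (ℕ.m≤n⇒m≤1+n (ℕ.m≤m⊔n m N))) δ>0)
  in t , t>0 , M , λ n M≤n → subst (_≤ δ + δ)
    (cong ∣_∣ (solve 2 (λ p q → p :+ (q :- p) := q) refl (series c t M) (series c t n)))
    (+-mono-∣∣ {series c t M} {series c t n - series c t M} small
      (near (ℚ.<⇒≤ t>0) t≤T (ℕ.m≤n⇒m≤1+n (ℕ.m≤n⊔m m N)) M≤n))

⊓-pos : ∀ {p q} → 0ℚ < p → 0ℚ < q → 0ℚ < p ⊓ q
⊓-pos {p} {q} p>0 q>0 with ℚ.⊓-sel p q
... | inj₁ e = subst (0ℚ <_) (sym e) p>0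
... | inj₂ e = subst (0ℚ <_) (sym e) q>0

crossing : ∀ {c} → Tame c → c 0 ≡ 1ℚ → ∀ {T m} → 0ℚ ≤ T →
  (∀ n → m ℕ.≤ n → series c T n ≤ 0ℚ) → Vanishing c
crossing {c} tame c0≡1 {T} T≥0 neg η η>0 =
  -- The minimum with 1 keeps the level below the starting value 1; the half leaves room for level
  -- and tail together.
  let (t , t>0 , N , small) = crossing-within {c} tame c0≡1 {T} T≥0 neg {1ℚ ⊓ (½ * η)}
        (⊓-pos {1ℚ} {½ * η} (ℚ.positive⁻¹ 1ℚ) (*-pos {½} {η} 0<½ η>0)) (ℚ.p⊓q≤p 1ℚ (½ * η))
  in t , t>0 , N , λ n N≤n → ℚ.≤-trans (small n N≤n)
      (≤-transfer (ℚ.+-mono-≤ (ℚ.p⊓q≤q 1ℚ (½ * η)) (ℚ.p⊓q≤q 1ℚ (½ * η)))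
        (solve 2 (λ d η → d :+ d :+ (con ½ :* η :+ con ½ :* η) := η :+ (d :+ d)) refl (1ℚ ⊓ (½ * η)) η))

-- Walks on a path

-- The real and imaginary parts of the k-th power of the imaginary unit.
reI imI : ℕ → ℚ
reI zero    = 1ℚ
reI (suc k) = - imI k
imI zero    = 0ℚ
imI (suc k) = reI k

-- The number of walks of length k to a target vertex of a path, from the vertex that lies
-- p - q places to the right of the target and has x vertices to its left, y to its right.
walks leftward rightward : (k p q x y : ℕ) → ℚ
walks zero    p q x y = if p ℕ.≡ᵇ q then 1ℚ else 0ℚ
walks (suc k) p q x y = leftward k p q x y + rightward k p q x y
leftward k p q zero    y = 0ℚ
leftward k p q (suc x) y = walks k p (suc q) x (suc y)
rightward k p q x zero    = 0ℚ
rightward k p q x (suc y) = walks k (suc p) q (suc x) y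

-- The coefficient of t^k/k! in U(t)_{u,u} for a vertex u with l vertices to its left and r to its
-- right.
returns : (l r k : ℕ) → ℚ
returns l r k = reI k * walks k 0 0 l r

-- An end of a path with at most three vertices.
Short : ℕ → ℕ → Set
Short l r = (l ≡ 0 × r ℕ.≤ 2) ⊎ (r ≡ 0 × l ℕ.≤ 2)

∣reI∣≤1 : ∀ k → ∣ reI k ∣ ≤ 1ℚ
∣imI∣≤1 : ∀ k → ∣ imI k ∣ ≤ 1ℚ
∣reI∣≤1 zero    = ℚ.≤-refl
∣reI∣≤1 (suc k) = subst (_≤ 1ℚ) (sym (ℚ.∣-p∣≡∣p∣ (imI k))) (∣imI∣≤1 k)
∣imI∣≤1 zero    = 0≤1
∣imI∣≤1 (suc k) = ∣reI∣≤1 k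

2^-nonNeg : ∀ k → 0ℚ ≤ 2ℚ ^ k
2^-nonNeg zero    = 0≤1
2^-nonNeg (suc k) = double≥0 (2ℚ ^ k) (2^-nonNeg k)

walks-bound : ∀ k p q x y → ∣ walks k p q x y ∣ ≤ 2ℚ ^ k
leftward-bound : ∀ k p q x y → ∣ leftward k p q x y ∣ ≤ 2ℚ ^ k
rightward-bound : ∀ k p q x y → ∣ rightward k p q x y ∣ ≤ 2ℚ ^ k
walks-bound zero p q x y with p ℕ.≡ᵇ q
... | false = 0≤1
... | true  = ℚ.≤-refl
walks-bound (suc k) p q x y = subst (∣ walks (suc k) p q x y ∣ ≤_)
  (trans (cong₂ _+_ (sym (ℚ.*-identityˡ (2ℚ ^ k))) (sym (ℚ.*-identityˡ (2ℚ ^ k))))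
    (trans (sym (ℚ.*-distribʳ-+ (2ℚ ^ k) 1ℚ 1ℚ)) (cong (_* 2ℚ ^ k) (sym 2ℚ≡1+1))))
  (+-mono-∣∣ {leftward k p q x y} {rightward k p q x y} (leftward-bound k p q x y) (rightward-bound k p q x y))
leftward-bound k p q zero    y = 2^-nonNeg k
leftward-bound k p q (suc x) y = walks-bound k p (suc q) x (suc y)
rightward-bound k p q x zero    = 2^-nonNeg k
rightward-bound k p q x (suc y) = walks-bound k (suc p) q (suc x) y

scaled-tame : ∀ (a c : ℕ → ℚ) → (∀ k → ∣ a k ∣ ≤ 1ℚ) → Tame c → Tame (λ k → a k * c k)
scaled-tame a c a≤1 tame k = subst (∣ a k * c k ∣ ≤_) (ℚ.*-identityˡ (2ℚ ^ k))
  (*-mono-∣∣ {a k} {c k} (a≤1 k) (tame k))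

returns-tame : ∀ l r → Tame (returns l r)
returns-tame l r = scaled-tame reI (λ k → walks k 0 0 l r) ∣reI∣≤1 (λ k → walks-bound k 0 0 l r)

≡ᵇ-sym : ∀ p q → (p ℕ.≡ᵇ q) ≡ (q ℕ.≡ᵇ p)
≡ᵇ-sym zero    zero    = refl
≡ᵇ-sym zero    (suc q) = refl
≡ᵇ-sym (suc p) zero    = refl
≡ᵇ-sym (suc p) (suc q) = ≡ᵇ-sym p q

walks-mirror : ∀ k p q x y → walks k p q x y ≡ walks k q p y x
leftward-mirror : ∀ k p q x y → leftward k p q x y ≡ rightward k q p y x
walks-mirror zero p q x y = cong (if_then 1ℚ else 0ℚ) (≡ᵇ-sym p q)
walks-mirror (suc k) p q x y = trans (ℚ.+-comm (leftward k p q x y) (rightward k p q x y))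
  (cong₂ _+_ (sym (leftward-mirror k q p y x)) (leftward-mirror k p q x y))
leftward-mirror k p q zero    y = refl
leftward-mirror k p q (suc x) y = walks-mirror k p (suc q) x (suc y)

-- Only p - q matters. A step to the left is recorded by raising q, whereas in the matrix it lowers
-- the row index p; this lemma reconciles the two.
walks-shift : ∀ k p q x y → walks k (suc p) (suc q) x y ≡ walks k p q x y
walks-shift zero p q x y = refl
walks-shift (suc k) p q x y = cong₂ _+_ (left x) (right y)
  where
  left : ∀ x → leftward k (suc p) (suc q) x y ≡ leftward k p q x y
  left zero    = refl
  left (suc x) = walks-shift k p (suc q) x (suc y)
  right : ∀ y → rightward k (suc p) (suc q) x y ≡ rightward k p q x y
  right zero    = refl
  right (suc y) = walks-shift k (suc p) q (suc x) y

walks-diagonal : ∀ k p x y → walks k p p x y ≡ walks k 0 0 x y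
walks-diagonal k zero    x y = refl
walks-diagonal k (suc p) x y = trans (walks-shift k p p x y) (walks-diagonal k p x y)

<⇒≡ᵇ-false : ∀ {p q} → p ℕ.< q → (p ℕ.≡ᵇ q) ≡ false
<⇒≡ᵇ-false {zero}  {suc q} _         = refl
<⇒≡ᵇ-false {suc p} {suc q} (ℕ.s≤s p<q) = <⇒≡ᵇ-false p<q

walks-unreachable : ∀ k p q x y → p ℕ.+ k ℕ.< q → walks k p q x y ≡ 0ℚ
walks-unreachable zero p q x y far =
  cong (if_then 1ℚ else 0ℚ) (<⇒≡ᵇ-false (subst (ℕ._< q) (ℕ.+-identityʳ p) far))
walks-unreachable (suc k) p q x y far = cong₂ _+_ (left x) (right y)
  where
  far′ : suc p ℕ.+ k ℕ.< q
  far′ = subst (ℕ._< q) (ℕ.+-suc p k) far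
  left : ∀ x → leftward k p q x y ≡ 0ℚ
  left zero    = refl
  left (suc x) = walks-unreachable k p (suc q) x (suc y) (ℕ.m<n⇒m<1+n (ℕ.<-trans (ℕ.n<1+n _) far′))
  right : ∀ y → rightward k p q x y ≡ 0ℚ
  right zero    = refl
  right (suc y) = walks-unreachable k (suc p) q (suc x) y far′

-- Either x = x′, or a walk of length k that runs into the left end for one of the two values
-- is too short to come back to the target.
Alike : (k p q x x′ : ℕ) → Set
Alike k p q x x′ = x ≡ x′ ⊎ (k ℕ.+ p ℕ.≤ x ℕ.+ x ℕ.+ q × k ℕ.+ p ℕ.≤ x′ ℕ.+ x′ ℕ.+ q)

private
  nearer : ∀ {k p q} x → suc k ℕ.+ p ℕ.≤ suc x ℕ.+ suc x ℕ.+ q → k ℕ.+ p ℕ.≤ x ℕ.+ x ℕ.+ suc q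
  nearer {k} {p} {q} x (ℕ.s≤s h) = subst (k ℕ.+ p ℕ.≤_)
    (trans (cong (ℕ._+ q) (ℕ.+-suc x x)) (sym (ℕ.+-suc (x ℕ.+ x) q))) h

  farther : ∀ {k p q} x → suc k ℕ.+ p ℕ.≤ x ℕ.+ x ℕ.+ q → k ℕ.+ suc p ℕ.≤ suc x ℕ.+ suc x ℕ.+ q
  farther {k} {p} {q} x h = ℕ.≤-trans (subst (ℕ._≤ x ℕ.+ x ℕ.+ q) (sym (ℕ.+-suc k p)) h)
    (ℕ.+-monoˡ-≤ q (ℕ.+-mono-≤ (ℕ.n≤1+n x) (ℕ.n≤1+n x)))

  alike-nearer : ∀ {k p q x x′} → Alike (suc k) p q (suc x) (suc x′) → Alike k p (suc q) x x′
  alike-nearer (inj₁ e) = inj₁ (ℕ.suc-injective e)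
  alike-nearer {k} {p} {q} {x} {x′} (inj₂ (h , h′)) = inj₂ (nearer {k} {p} {q} x h , nearer {k} {p} {q} x′ h′)

  alike-farther : ∀ {k p q x x′} → Alike (suc k) p q x x′ → Alike k (suc p) q (suc x) (suc x′)
  alike-farther (inj₁ e) = inj₁ (cong suc e)
  alike-farther {k} {p} {q} {x} {x′} (inj₂ (h , h′)) = inj₂ (farther {k} {p} {q} x h , farther {k} {p} {q} x′ h′)

-- The inequality k + p ≤ 2x + q survives every step: a step left lowers both sides by one, a step
-- right leaves the left side and raises the right side by two. If only one of the two left arms is
-- exhausted, it forces the target out of reach for the other walk as well, so both counts are 0.
-- Right arms reduce to left ones by reflection.
walks-local : ∀ k p q x x′ y y′ → Alike k p q x x′ → Alike k q p y y′ →
  walks k p q x y ≡ walks k p q x′ y′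
leftward-local : ∀ k p q x x′ y y′ → Alike (suc k) p q x x′ → Alike (suc k) q p y y′ →
  leftward k p q x y ≡ leftward k p q x′ y′
walks-local zero    p q x x′ y y′ _ _ = refl
walks-local (suc k) p q x x′ y y′ ax ay = cong₂ _+_ (leftward-local k p q x x′ y y′ ax ay)
  (trans (sym (leftward-mirror k q p y x))
    (trans (leftward-local k q p y y′ x x′ ay ax) (leftward-mirror k q p y′ x′)))
leftward-local k p q zero zero y y′ _ _ = refl
leftward-local k p q (suc x) (suc x′) y y′ ax ay =
  walks-local k p (suc q) x x′ (suc y) (suc y′) (alike-nearer {k} {p} {q} ax) (alike-farther {k} {q} {p} ay)
leftward-local k p q zero (suc x′) y y′ (inj₂ (h , _)) _ =
  sym (walks-unreachable k p (suc q) x′ (suc y′) (ℕ.s≤s (subst (ℕ._≤ q) (ℕ.+-comm k p) (ℕ.≤-trans (ℕ.n≤1+n _) h))))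
leftward-local k p q (suc x) zero y y′ (inj₂ (_ , h)) _ =
  walks-unreachable k p (suc q) x (suc y) (ℕ.s≤s (subst (ℕ._≤ q) (ℕ.+-comm k p) (ℕ.≤-trans (ℕ.n≤1+n _) h)))

-- The sum k + p + q is constant along a walk, since each step lowers k and raises p or q. At k = 0
-- an odd sum excludes p = q.
walks-odd : ∀ k p q x y j → k ℕ.+ (p ℕ.+ q) ≡ suc (2 ℕ.* j) → walks k p q x y ≡ 0ℚ
walks-odd zero p q x y j odd = cong (if_then 1ℚ else 0ℚ) (different p q j odd)
  where
  different : ∀ p q j → p ℕ.+ q ≡ suc (2 ℕ.* j) → (p ℕ.≡ᵇ q) ≡ false
  different p q j odd with p ℕ.≡ᵇ q in eq
  ... | false = refl
  ... | true  = ⊥-elim (ℕ.even≢odd q j (trans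
    (cong₂ ℕ._+_ (sym (ℕ.≡ᵇ⇒≡ p q (subst T (sym eq) _))) (ℕ.+-identityʳ q)) odd))
walks-odd (suc k) p q x y j odd = cong₂ _+_ (left x) (right y)
  where
  odd′ : k ℕ.+ (suc p ℕ.+ q) ≡ suc (2 ℕ.* j)
  odd′ = trans (ℕ.+-suc k (p ℕ.+ q)) odd
  left : ∀ x → leftward k p q x y ≡ 0ℚ
  left zero    = refl
  left (suc x) = walks-odd k p (suc q) x (suc y) j (trans (cong (k ℕ.+_) (ℕ.+-suc p q)) odd′)
  right : ∀ y → rightward k p q x y ≡ 0ℚ
  right zero    = refl
  right (suc y) = walks-odd k (suc p) q (suc x) y j odd′

imI-even : ∀ k → imI k ≡ 0ℚ ⊎ ∃[ j ] k ≡ suc (2 ℕ.* j)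
imI-even zero          = inj₁ refl
imI-even (suc zero)    = inj₂ (0 , refl)
imI-even (suc (suc k)) with imI-even k
... | inj₁ e       = inj₁ (cong -_ e)
... | inj₂ (j , e) = inj₂ (suc j , trans (cong (2 ℕ.+_) e) (cong suc (sym (ℕ.*-suc 2 j))))

imI*walks≡0 : ∀ k x y → imI k * walks k 0 0 x y ≡ 0ℚ
imI*walks≡0 k x y with imI-even k
... | inj₁ e       = trans (cong (_* walks k 0 0 x y) e) (ℚ.*-zeroˡ (walks k 0 0 x y))
... | inj₂ (j , e) = trans (cong (imI k *_) (walks-odd k 0 0 x y j (trans (ℕ.+-identityʳ k) e))) (ℚ.*-zeroʳ (imI k))

alike-cap : ∀ {k} m x → k ℕ.≤ m ℕ.+ m → Alike k 0 0 x (x ℕ.⊓ m)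
alike-cap {k} m x k≤ with ℕ.≤-total x m
... | inj₁ x≤m = inj₁ (sym (ℕ.m≤n⇒m⊓n≡m x≤m))
... | inj₂ m≤x rewrite ℕ.m≥n⇒m⊓n≡n m≤x | ℕ.+-identityʳ k | ℕ.+-identityʳ (x ℕ.+ x) | ℕ.+-identityʳ (m ℕ.+ m) =
  inj₂ (ℕ.≤-trans k≤ (ℕ.+-mono-≤ m≤x m≤x) , k≤)

returns-cap : ∀ l r {k} m → k ℕ.≤ m ℕ.+ m → returns l r k ≡ returns (l ℕ.⊓ m) (r ℕ.⊓ m) k
returns-cap l r {k} m k≤ = cong (reI k *_)
  (walks-local k 0 0 l (l ℕ.⊓ m) r (r ℕ.⊓ m) (alike-cap m l k≤) (alike-cap m r k≤))

-- The sign at t = 2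

Σ<-cong : ∀ {a b} n → (∀ k → k ℕ.< n → a k ≡ b k) → Σ< a n ≡ Σ< b n
Σ<-cong zero    a≗b = refl
Σ<-cong (suc n) a≗b = cong₂ _+_ (Σ<-cong n λ k k<n → a≗b k (ℕ.m<n⇒m<1+n k<n)) (a≗b n ℕ.≤-refl)

-- The 4 is the time 2 multiplied by the base of the walk bound 2^k. The case k = 13 is computed;
-- afterwards the ratio 4/(k+1) is at most ½ because k + 1 ≥ 8.
ex4-bound : ∀ {k} → 13 ℕ.≤′ k → ex ⟦ 4 ⟧ k ≤ ⟦ 89 ⟧ * ½ ^ k
ex4-bound ℕ.≤′-refl = from-yes (ex ⟦ 4 ⟧ 13 ℚ.≤? ⟦ 89 ⟧ * ½ ^ 13)
ex4-bound {suc k} (ℕ.≤′-step 13≤k) = begin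
  ex ⟦ 4 ⟧ k * ⟦ 4 ⟧ * recip k
    ≡⟨ solve 3 (λ e f r → e :* f :* r := e :* (f :* r)) refl (ex ⟦ 4 ⟧ k) ⟦ 4 ⟧ (recip k) ⟩
  ex ⟦ 4 ⟧ k * (⟦ 4 ⟧ * recip k)
    ≤⟨ *-mono {ex ⟦ 4 ⟧ k} {⟦ 89 ⟧ * ½ ^ k} {⟦ 4 ⟧ * recip k} {½} (ex≥0 {⟦ 4 ⟧} (ℚ.nonNegative⁻¹ ⟦ 4 ⟧) k) 0≤½ (ex4-bound 13≤k) ratio ⟩
  ⟦ 89 ⟧ * ½ ^ k * ½
    ≡⟨ solve 3 (λ c h s → c :* h :* s := c :* (s :* h)) refl ⟦ 89 ⟧ (½ ^ k) ½ ⟩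
  ⟦ 89 ⟧ * (½ * ½ ^ k) ∎
  where
  open ≤-Reasoning
  4≡½*8 : ⟦ 4 ⟧ ≡ ½ * ⟦ 8 ⟧
  4≡½*8 = refl
  ratio : ⟦ 4 ⟧ * recip k ≤ ½
  ratio = begin
    ⟦ 4 ⟧ * recip k         ≡⟨ cong (_* recip k) 4≡½*8 ⟩
    ½ * ⟦ 8 ⟧ * recip k     ≡⟨ ℚ.*-assoc ½ ⟦ 8 ⟧ (recip k) ⟩
    ½ * (⟦ 8 ⟧ * recip k)   ≤⟨ *-monoʳ ½ 0≤½ (*-monoˡ (recip k) (recip≥0 k)
                                 (⟦⟧-mono (ℕ.m≤n⇒m≤1+n (ℕ.≤-trans (ℕ.m≤m+n 8 5) (ℕ.≤′⇒≤ 13≤k))))) ⟩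
    ½ * (⟦ suc k ⟧ * recip k) ≡⟨ cong (½ *_) (recip-inverse k) ⟩
    ½ * 1ℚ                  ≡⟨ ℚ.*-identityʳ ½ ⟩
    ½                       ∎

term-at-2 : ∀ {c} → Tame c → Geometric 13 ⟦ 89 ⟧ (term c ⟦ 2 ⟧)
term-at-2 {c} tame k 13≤k = ℚ.≤-trans
  (term-bound {c} tame {⟦ 2 ⟧} {⟦ 2 ⟧} (ℚ.nonNegative⁻¹ ⟦ 2 ⟧) ℚ.≤-refl k)
  (subst (λ t → ex t k ≤ ⟦ 89 ⟧ * ½ ^ k) (sym (cong (_* ⟦ 2 ⟧) 2ℚ≡⟦2⟧)) (ex4-bound (ℕ.≤⇒≤′ 13≤k)))

crossing-at-2 : ∀ {c} → Tame c → c 0 ≡ 1ℚ →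
  series c ⟦ 2 ⟧ 13 + (⟦ 89 ⟧ + ⟦ 89 ⟧) * ½ ^ 13 ≤ 0ℚ → Vanishing c
crossing-at-2 {c} tame c0≡1 neg = crossing {c} tame c0≡1 {⟦ 2 ⟧} {13} (ℚ.nonNegative⁻¹ ⟦ 2 ⟧) λ n 13≤n →
  ℚ.≤-trans
    (≤-transfer (ℚ.≤-trans (p≤∣p∣ (series c ⟦ 2 ⟧ n - series c ⟦ 2 ⟧ 13))
           (tail-bound {13} {⟦ 89 ⟧} {term c ⟦ 2 ⟧} (ℚ.nonNegative⁻¹ ⟦ 89 ⟧) (term-at-2 {c} tame) {13} {n} ℕ.≤-refl 13≤n))
      (solve 3 (λ S P t → S :+ t := (P :+ t) :+ (S :- P)) refl
        (series c ⟦ 2 ⟧ n) (series c ⟦ 2 ⟧ 13) ((⟦ 89 ⟧ + ⟦ 89 ⟧) * ½ ^ 13)))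
    neg

-- Closed walks of length at most 12 stay within distance 6, so 6 stands for all larger arms;
-- 89 comes from 4¹³/13! ≤ 89/2¹³.
Settled : Fin 7 → Fin 7 → Set
Settled l r = Short (toℕ l) (toℕ r) ⊎
  series (returns (toℕ l) (toℕ r)) ⟦ 2 ⟧ 13 + (⟦ 89 ⟧ + ⟦ 89 ⟧) * ½ ^ 13 ≤ 0ℚ

settled? : ∀ l r → Dec (Settled l r)
settled? l r = (((toℕ l ℕ.≟ 0) ×-dec (toℕ r ℕ.≤? 2)) ⊎-dec ((toℕ r ℕ.≟ 0) ×-dec (toℕ l ℕ.≤? 2))) ⊎-dec
  (series (returns (toℕ l) (toℕ r)) ⟦ 2 ⟧ 13 + (⟦ 89 ⟧ + ⟦ 89 ⟧) * ½ ^ 13 ℚ.≤? 0ℚ)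

opaque

  -- Forty-nine exact rational evaluations; opacity keeps the computed proof from unfolding where it
  -- is applied.
  settled : ∀ l r → Settled l r
  settled = from-yes (Fin.all? λ l → Fin.all? (settled? l))

short-uncap : ∀ l r → Short (l ℕ.⊓ 6) (r ℕ.⊓ 6) → Short l r
short-uncap l r (inj₁ (l0 , r2)) = inj₁ (trans (sym (uncap l (ℕ.≤-trans (ℕ.≤-reflexive l0) ℕ.z≤n))) l0 , subst (ℕ._≤ 2) (uncap r r2) r2)
  where
  uncap : ∀ x → x ℕ.⊓ 6 ℕ.≤ 2 → x ℕ.⊓ 6 ≡ x
  uncap x x2 with ℕ.⊓-sel x 6
  ... | inj₁ e = e
  ... | inj₂ e with ℕ.s≤s (ℕ.s≤s ()) ← ℕ.≤-trans (ℕ.≤-reflexive (sym e)) x2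
short-uncap l r (inj₂ (r0 , l2)) with short-uncap r l (inj₁ (r0 , l2))
... | inj₁ rl = inj₂ rl
... | inj₂ lr = inj₁ lr

returns-vanishing : ∀ l r → Short l r ⊎ Vanishing (returns l r)
returns-vanishing l r = conclude (settled (cap l) (cap r))
  where
  cap : ℕ → Fin 7
  cap x = fromℕ< (ℕ.s≤s (ℕ.m⊓n≤n x 6))
  toℕ-cap : ∀ x → toℕ (cap x) ≡ x ℕ.⊓ 6
  toℕ-cap x = Fin.toℕ-fromℕ< (ℕ.s≤s (ℕ.m⊓n≤n x 6))
  Bounded : ℚ → Set
  Bounded S = S + (⟦ 89 ⟧ + ⟦ 89 ⟧) * ½ ^ 13 ≤ 0ℚ
  conclude : Settled (cap l) (cap r) → Short l r ⊎ Vanishing (returns l r)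
  conclude (inj₁ short) = inj₁ (short-uncap l r (subst₂ Short (toℕ-cap l) (toℕ-cap r) short))
  conclude (inj₂ neg)   = inj₂ (crossing-at-2 {returns l r} (returns-tame l r) refl
    (subst Bounded
      (trans (cong₂ (λ l r → series (returns l r) ⟦ 2 ⟧ 13) (toℕ-cap l) (toℕ-cap r))
        (sym (Σ<-cong 13 λ k k<13 → cong (_* ex ⟦ 2 ⟧ k) (returns-cap l r 6 (ℕ.s≤s⁻¹ k<13)))))
      neg))

-- Cauchy products and formal derivatives

conv : (ℕ → ℚ) → (ℕ → ℚ) → ℕ → ℚ
conv a b zero    = a 0 * b 0
conv a b (suc k) = a 0 * b (suc k) + conv (a ∘ suc) b k

conv-cong : ∀ {a a′ b b′} → (∀ k → a k ≡ a′ k) → (∀ k → b k ≡ b′ k) → ∀ k → conv a b k ≡ conv a′ b′ k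
conv-cong a≗ b≗ zero    = cong₂ _*_ (a≗ 0) (b≗ 0)
conv-cong a≗ b≗ (suc k) = cong₂ _+_ (cong₂ _*_ (a≗ 0) (b≗ (suc k))) (conv-cong (a≗ ∘ suc) b≗ k)

conv-*ˡ : ∀ r a b k → conv (λ j → r * a j) b k ≡ r * conv a b k
conv-*ˡ r a b zero    = ℚ.*-assoc r (a 0) (b 0)
conv-*ˡ r a b (suc k) = trans (cong ((r * a 0 * b (suc k)) +_) (conv-*ˡ r (a ∘ suc) b k))
  (solve 4 (λ r x y c → r :* x :* y :+ r :* c := r :* (x :* y :+ c)) refl r (a 0) (b (suc k)) (conv (a ∘ suc) b k))

conv-*ʳ : ∀ r a b k → conv a (λ j → r * b j) k ≡ r * conv a b k
conv-*ʳ r a b zero    = solve 3 (λ r x y → x :* (r :* y) := r :* (x :* y)) refl r (a 0) (b 0)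
conv-*ʳ r a b (suc k) = trans (cong ((a 0 * (r * b (suc k))) +_) (conv-*ʳ r (a ∘ suc) b k))
  (solve 4 (λ r x y c → x :* (r :* y) :+ r :* c := r :* (x :* y :+ c)) refl r (a 0) (b (suc k)) (conv (a ∘ suc) b k))

conv-+ˡ : ∀ a a′ b k → conv (λ j → a j + a′ j) b k ≡ conv a b k + conv a′ b k
conv-+ˡ a a′ b zero    = ℚ.*-distribʳ-+ (b 0) (a 0) (a′ 0)
conv-+ˡ a a′ b (suc k) = trans (cong (((a 0 + a′ 0) * b (suc k)) +_) (conv-+ˡ (a ∘ suc) (a′ ∘ suc) b k))
  (solve 5 (λ x x′ y c c′ → (x :+ x′) :* y :+ (c :+ c′) := (x :* y :+ c) :+ (x′ :* y :+ c′)) refl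
    (a 0) (a′ 0) (b (suc k)) (conv (a ∘ suc) b k) (conv (a′ ∘ suc) b k))

-- The coefficients of the formal derivative.
D : (ℕ → ℚ) → ℕ → ℚ
D a k = ⟦ suc k ⟧ * a (suc k)

leibniz : ∀ a b k → D (conv a b) k ≡ conv (D a) b k + conv a (D b) k
leibniz a b zero = solve 5 (λ n a₀ a₁ b₀ b₁ → n :* (a₀ :* b₁ :+ a₁ :* b₀) := n :* a₁ :* b₀ :+ a₀ :* (n :* b₁)) refl
  ⟦ 1 ⟧ (a 0) (a 1) (b 0) (b 1)
leibniz a b (suc k) = begin
  ⟦ suc (suc k) ⟧ * (a 0 * b (suc (suc k)) + conv a′ b (suc k))
    ≡⟨ ℚ.*-distribˡ-+ ⟦ suc (suc k) ⟧ (a 0 * b (suc (suc k))) (conv a′ b (suc k)) ⟩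
  ⟦ suc (suc k) ⟧ * (a 0 * b (suc (suc k))) + ⟦ suc (suc k) ⟧ * conv a′ b (suc k)
    ≡⟨ cong ((⟦ suc (suc k) ⟧ * (a 0 * b (suc (suc k)))) +_)
         (trans (cong (_* conv a′ b (suc k)) (⟦⟧-suc (suc k)))
           (trans (ℚ.*-distribʳ-+ (conv a′ b (suc k)) ⟦ suc k ⟧ 1ℚ)
             (cong₂ _+_ (leibniz a′ b k) (ℚ.*-identityˡ (conv a′ b (suc k)))))) ⟩
  ⟦ suc (suc k) ⟧ * (a 0 * b (suc (suc k))) +
    (conv (D a′) b k + conv a′ (D b) k + (a 1 * b (suc k) + conv (a′ ∘ suc) b k))
    ≡⟨ solve 8 (λ n a₀ b₂ x y a₁ b₁ z →
         n :* (a₀ :* b₂) :+ (x :+ y :+ (a₁ :* b₁ :+ z)) := (a₁ :* b₁ :+ (x :+ z)) :+ (a₀ :* (n :* b₂) :+ y)) refl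
         ⟦ suc (suc k) ⟧ (a 0) (b (suc (suc k))) (conv (D a′) b k) (conv a′ (D b) k) (a 1) (b (suc k)) (conv (a′ ∘ suc) b k) ⟩
  (a 1 * b (suc k) + (conv (D a′) b k + conv (a′ ∘ suc) b k)) + conv a (D b) (suc k)
    ≡⟨ cong (_+ conv a (D b) (suc k)) (cong₂ _+_ (cong (_* b (suc k)) (sym (ℚ.*-identityˡ (a 1))))
         (trans (sym (conv-+ˡ (D a′) (a′ ∘ suc) b k)) (conv-cong shifted (λ _ → refl) k))) ⟩
  conv (D a) b (suc k) + conv a (D b) (suc k) ∎
  where
  open ≡-Reasoning
  a′ : ℕ → ℚ
  a′ = a ∘ suc
  -- The derivative of the shifted sequence has a weight too small by one; the extra copy from k + 2
  -- = (k + 1) + 1 makes up for it.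
  shifted : ∀ j → D a′ j + a′ (suc j) ≡ D a (suc j)
  shifted j = sym (trans (cong (_* a (suc (suc j))) (⟦⟧-suc (suc j)))
    (trans (ℚ.*-distribʳ-+ (a (suc (suc j))) ⟦ suc j ⟧ 1ℚ)
      (cong ((⟦ suc j ⟧ * a (suc (suc j))) +_) (ℚ.*-identityˡ (a (suc (suc j)))))))

-- The sum of a_i b_j over i + j < n, arranged by rows i.
triangle : (ℕ → ℚ) → (ℕ → ℚ) → ℕ → ℚ
triangle a b zero    = 0ℚ
triangle a b (suc n) = a 0 * Σ< b (suc n) + triangle (a ∘ suc) b n

triangle-step : ∀ a b n → triangle a b (suc n) ≡ triangle a b n + conv a b n
triangle-step a b zero    = solve 2 (λ x y → x :* (con 0ℚ :+ y) :+ con 0ℚ := con 0ℚ :+ x :* y) refl (a 0) (b 0)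
triangle-step a b (suc n) = trans (cong ((a 0 * Σ< b (suc (suc n))) +_) (triangle-step (a ∘ suc) b n))
  (solve 5 (λ x S y t c → x :* (S :+ y) :+ (t :+ c) := (x :* S :+ t) :+ (x :* y :+ c)) refl
    (a 0) (Σ< b (suc n)) (b (suc n)) (triangle (a ∘ suc) b n) (conv (a ∘ suc) b n))

triangle-conv : ∀ a b n → triangle a b n ≡ Σ< (conv a b) n
triangle-conv a b zero    = refl
triangle-conv a b (suc n) = trans (triangle-step a b n) (cong (_+ conv a b n) (triangle-conv a b n))

Σ<-head : ∀ a n → Σ< a (suc n) ≡ a 0 + Σ< (a ∘ suc) n
Σ<-head a zero    = ℚ.+-comm 0ℚ (a 0)
Σ<-head a (suc n) = trans (cong (_+ a (suc n)) (Σ<-head a n)) (ℚ.+-assoc (a 0) (Σ< (a ∘ suc) n) (a (suc n)))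

-- Row i of the triangle lacks a_i times a tail of b, at most C ¼^i E ½^(n-i) = C E ½^n ½^i; summing
-- over i gives 2 C E ½^n. In the induction, removing the first row replaces C by C/4.
cauchy-product : ∀ {a b C E M} → 0ℚ ≤ C → (∀ k → ∣ a k ∣ ≤ C * (½ ^ k * ½ ^ k)) →
  (∀ n → n ℕ.≤ M → ∣ Σ< b M - Σ< b n ∣ ≤ E * ½ ^ n) → ∀ n → n ℕ.≤ M →
  ∣ Σ< a n * Σ< b M - triangle a b n ∣ ≤ (C * E + C * E) * ½ ^ n
cauchy-product {a} {b} {C} {E} {M} C≥0 a≤ b≤ zero _ = subst (_≤ (C * E + C * E) * 1ℚ)
  (sym (cong (λ z → ∣ z - 0ℚ ∣) (ℚ.*-zeroˡ (Σ< b M))))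
  (*-nonNeg {C * E + C * E} {1ℚ} (+-nonNeg {C * E} {C * E} CE≥0 CE≥0) 0≤1)
  where
  E≥0 : 0ℚ ≤ E
  E≥0 = ℚ.≤-trans (ℚ.0≤∣p∣ (Σ< b M - 0ℚ)) (subst (∣ Σ< b M - 0ℚ ∣ ≤_) (ℚ.*-identityʳ E) (b≤ 0 ℕ.z≤n))
  CE≥0 : 0ℚ ≤ C * E
  CE≥0 = *-nonNeg {C} {E} C≥0 E≥0
cauchy-product {a} {b} {C} {E} {M} C≥0 a≤ b≤ (suc n) n<M = begin
  ∣ Σ< a (suc n) * B - (a 0 * Bₙ + t) ∣
    ≡⟨ cong (λ S → ∣ S * B - (a 0 * Bₙ + t) ∣) (Σ<-head a n) ⟩
  ∣ (a 0 + S) * B - (a 0 * Bₙ + t) ∣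
    ≡⟨ cong ∣_∣ (solve 5 (λ x S B Bₙ t → (x :+ S) :* B :- (x :* Bₙ :+ t) := x :* (B :- Bₙ) :+ (S :* B :- t)) refl
         (a 0) S B Bₙ t) ⟩
  ∣ a 0 * (B - Bₙ) + (S * B - t) ∣
    ≤⟨ +-mono-∣∣ {a 0 * (B - Bₙ)} {S * B - t}
         (*-mono-∣∣ {a 0} {B - Bₙ} (subst (∣ a 0 ∣ ≤_) (ℚ.*-identityʳ C) (a≤ 0)) (b≤ (suc n) n<M))
         (cauchy-product {a ∘ suc} {b} {½ * (½ * C)} {E} {M}
           (*-nonNeg {½} {½ * C} 0≤½ (*-nonNeg {½} {C} 0≤½ C≥0))
           (λ k → subst (∣ a (suc k) ∣ ≤_)
             (solve 3 (λ C g h → C :* ((g :* h) :* (g :* h)) := g :* (g :* C) :* (h :* h)) refl C ½ (½ ^ k))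
             (a≤ (suc k)))
           b≤ n (ℕ.<⇒≤ n<M)) ⟩
  C * (E * (½ * h)) + (½ * (½ * C) * E + ½ * (½ * C) * E) * h
    ≡⟨ solve 3 (λ C E h → C :* (E :* (con ½ :* h)) :+ (con ½ :* (con ½ :* C) :* E :+ con ½ :* (con ½ :* C) :* E) :* h
                := (C :* E :+ C :* E) :* (con ½ :* h)) refl C E h ⟩
  (C * E + C * E) * (½ * h) ∎
  where
  open ≤-Reasoning
  S = Σ< (a ∘ suc) n
  B = Σ< b M
  Bₙ = Σ< b (suc n)
  t = triangle (a ∘ suc) b n
  h = ½ ^ n

*-cancel-⟦suc⟧ : ∀ k {x y} → ⟦ suc k ⟧ * x ≡ ⟦ suc k ⟧ * y → x ≡ y
*-cancel-⟦suc⟧ k {x} {y} eq = trans (sym (restore x)) (trans (cong (recip k *_) eq) (restore y))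
  where
  restore : ∀ z → recip k * (⟦ suc k ⟧ * z) ≡ z
  restore z = trans (solve 3 (λ r n z → r :* (n :* z) := n :* r :* z) refl (recip k) ⟦ suc k ⟧ z)
    (trans (cong (_* z) (recip-inverse k)) (ℚ.*-identityˡ z))

-- The terms at time t are the coefficients of x^k in the series at time t x; differentiation in x
-- brings out t and shifts c.
D-term : ∀ c t k → D (term c t) k ≡ t * (c (suc k) * ex t k)
D-term c t k = begin
  ⟦ suc k ⟧ * (c (suc k) * ex t (suc k))
    ≡⟨ solve 3 (λ n c e → n :* (c :* e) := c :* (n :* e)) refl ⟦ suc k ⟧ (c (suc k)) (ex t (suc k)) ⟩
  c (suc k) * (⟦ suc k ⟧ * ex t (suc k))
    ≡⟨ cong (c (suc k) *_) (ex-suc t k) ⟩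
  c (suc k) * (ex t k * t)
    ≡⟨ solve 3 (λ c e t → c :* (e :* t) := t :* (c :* e)) refl (c (suc k)) (ex t k) t ⟩
  t * (c (suc k) * ex t k) ∎
  where open ≡-Reasoning

-- The path on three vertices and the double angle

δ₀ : ℕ → ℚ
δ₀ zero    = 1ℚ
δ₀ (suc k) = 0ℚ

-- On P₃: cosₘ is cos √2t, sinₘ is sin √2t / √2, cosₑ is (1 + cos √2t)/2 and sinₑ = sinₘ.
cosₘ sinₘ cosₑ sinₑ : ℕ → ℚ
cosₘ = returns 1 1
sinₘ k = imI k * walks k 0 1 0 2
cosₑ = returns 0 2
sinₑ k = imI k * walks k 1 0 1 1

-- Shifting the coefficients differentiates an exponential generating series, so the four
-- recurrences read cosₘ' = -2 sinₘ, sinₘ' = cosₘ, cosₑ' = -sinₑ and sinₑ' = 2 cosₑ - 1.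
cosₘ-suc : ∀ k → cosₘ (suc k) ≡ - (sinₘ k + sinₘ k)
cosₘ-suc k = trans (cong (λ w → - imI k * (walks k 0 1 0 2 + w)) (walks-mirror k 1 0 2 0))
  (solve 2 (λ m w → (:- m) :* (w :+ w) := :- (m :* w :+ m :* w)) refl (imI k) (walks k 0 1 0 2))

sinₘ-suc : ∀ k → sinₘ (suc k) ≡ cosₘ k
sinₘ-suc k = cong (reI k *_) (trans (ℚ.+-identityˡ (walks k 1 1 1 1)) (walks-shift k 0 0 1 1))

cosₑ-suc : ∀ k → cosₑ (suc k) ≡ - sinₑ k
cosₑ-suc k = solve 2 (λ m w → (:- m) :* (con 0ℚ :+ w) := :- (m :* w)) refl (imI k) (walks k 1 0 1 1)

sinₑ-suc : ∀ k → sinₑ (suc k) ≡ (cosₑ k + cosₑ k) - δ₀ k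
sinₑ-suc k = trans (cong (λ w → reI k * (w + walks k 2 0 2 0)) (walks-shift k 0 0 0 2)) (opposite k)
  where
  -- Both ends have the middle vertex as their only neighbour, so walks from either end agree in
  -- number from length 1 on; length 0 accounts for `δ₀`.
  opposite : ∀ k → reI k * (walks k 0 0 0 2 + walks k 2 0 2 0) ≡ (cosₑ k + cosₑ k) - δ₀ k
  opposite zero    = refl
  opposite (suc k) = trans
    (cong (λ w → reI (suc k) * (walks (suc k) 0 0 0 2 + w))
      (trans (ℚ.+-identityʳ (walks k 2 1 1 1)) (trans (walks-shift k 1 0 1 1) (sym (ℚ.+-identityˡ (walks k 1 0 1 1))))))
    (solve 2 (λ r w → r :* (w :+ w) := (r :* w :+ r :* w) :- con 0ℚ) refl (reI (suc k)) (walks (suc k) 0 0 0 2))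

-- Both sides of cosₑ(2s) = cosₘ(s)² solve the same linear system of differential
-- equations in s; cosₘ² + 2 sinₘ² = 1 closes the system on the right.
module DoubleAngle (s : ℚ) where

  A B X W Z H V : ℕ → ℚ
  A = term cosₘ s
  B = term sinₘ s
  X = conv A A
  W k = conv A B k + conv B A k
  Z = conv B B
  H = term cosₑ (s + s)
  V = term sinₑ (s + s)

  D-A : ∀ k → D A k ≡ - (s + s) * B k
  D-A k = trans (D-term cosₘ s k) (trans (cong (λ c → s * (c * ex s k)) (cosₘ-suc k))
    (solve 3 (λ s b e → s :* ((:- (b :+ b)) :* e) := (:- (s :+ s)) :* (b :* e)) refl s (sinₘ k) (ex s k)))

  D-B : ∀ k → D B k ≡ s * A k
  D-B k = trans (D-term sinₘ s k) (cong (λ c → s * (c * ex s k)) (sinₘ-suc k))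

  D-conv : ∀ a b {r q a′ b′} → (∀ k → D a k ≡ r * a′ k) → (∀ k → D b k ≡ q * b′ k) →
    ∀ k → D (conv a b) k ≡ r * conv a′ b k + q * conv a b′ k
  D-conv a b {r} {q} {a′} {b′} Da Db k = trans (leibniz a b k) (cong₂ _+_
    (trans (conv-cong {b = b} Da (λ _ → refl) k) (conv-*ˡ r a′ b k))
    (trans (conv-cong {a} (λ _ → refl) Db k) (conv-*ʳ q a b′ k)))

  D-X : ∀ k → D X k ≡ - (s + s) * W k
  D-X k = trans (D-conv A A { - (s + s)} { - (s + s)} {B} {B} D-A D-A k)
    (solve 3 (λ r x y → r :* x :+ r :* y := r :* (y :+ x)) refl (- (s + s)) (conv B A k) (conv A B k))

  D-Z : ∀ k → D Z k ≡ s * W k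
  D-Z k = trans (D-conv B B {s} {s} {A} {A} D-B D-B k) (sym (ℚ.*-distribˡ-+ s (conv A B k) (conv B A k)))

  D-W : ∀ k → D W k ≡ (s + s) * (X k - (Z k + Z k))
  D-W k = trans (ℚ.*-distribˡ-+ ⟦ suc k ⟧ (conv A B (suc k)) (conv B A (suc k)))
    (trans (cong₂ _+_ (D-conv A B { - (s + s)} {s} {B} {A} D-A D-B k) (D-conv B A {s} { - (s + s)} {A} {B} D-B D-A k))
      (solve 3 (λ s x z → ((:- (s :+ s)) :* z :+ s :* x) :+ (s :* x :+ (:- (s :+ s)) :* z) := (s :+ s) :* (x :- (z :+ z))) refl
        s (X k) (Z k)))

  pythagoras : ∀ k → X k + (Z k + Z k) ≡ δ₀ k
  pythagoras zero    = refl
  pythagoras (suc k) = *-cancel-⟦suc⟧ k (begin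
    ⟦ suc k ⟧ * (X (suc k) + (Z (suc k) + Z (suc k)))
      ≡⟨ solve 3 (λ n x z → n :* (x :+ (z :+ z)) := n :* x :+ (n :* z :+ n :* z)) refl ⟦ suc k ⟧ (X (suc k)) (Z (suc k)) ⟩
    D X k + (D Z k + D Z k)
      ≡⟨ cong₂ _+_ (D-X k) (cong₂ _+_ (D-Z k) (D-Z k)) ⟩
    - (s + s) * W k + (s * W k + s * W k)
      ≡⟨ solve 3 (λ s w n → (:- (s :+ s)) :* w :+ (s :* w :+ s :* w) := n :* con 0ℚ) refl s (W k) ⟦ suc k ⟧ ⟩
    ⟦ suc k ⟧ * 0ℚ ∎)
    where open ≡-Reasoning

  D-W′ : ∀ k → D W k ≡ (s + s) * ((X k + X k) - δ₀ k)
  D-W′ k = trans (D-W k) (cong ((s + s) *_)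
    (trans (solve 2 (λ x z → x :- (z :+ z) := (x :+ x) :- (x :+ (z :+ z))) refl (X k) (Z k))
      (cong (λ d → (X k + X k) - d) (pythagoras k))))

  D-H : ∀ k → D H k ≡ - (s + s) * V k
  D-H k = trans (D-term cosₑ (s + s) k) (trans (cong (λ c → (s + s) * (c * ex (s + s) k)) (cosₑ-suc k))
    (solve 3 (λ t b e → t :* ((:- b) :* e) := (:- t) :* (b :* e)) refl (s + s) (sinₑ k) (ex (s + s) k)))

  D-V : ∀ k → D V k ≡ (s + s) * ((H k + H k) - δ₀ k)
  D-V k = trans (D-term sinₑ (s + s) k) (cong ((s + s) *_)
    (trans (cong (_* ex (s + s) k) (sinₑ-suc k))
      (trans (solve 3 (λ c d e → ((c :+ c) :- d) :* e := (c :* e :+ c :* e) :- d :* e) refl (cosₑ k) (δ₀ k) (ex (s + s) k))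
        (cong (λ d → (H k + H k) - d) (δ₀-ex k)))))
    where
    δ₀-ex : ∀ k → δ₀ k * ex (s + s) k ≡ δ₀ k
    δ₀-ex zero    = refl
    δ₀-ex (suc k) = ℚ.*-zeroˡ (ex (s + s) (suc k))

  -- On coefficients the linear system determines order k + 1 from order k, after division by k + 1,
  -- so uniqueness of its solution is a plain induction.
  same : ∀ k → X k ≡ H k × W k ≡ V k
  same zero    = refl , refl
  same (suc k) = let (X≡H , W≡V) = same k in
    *-cancel-⟦suc⟧ k (trans (D-X k) (trans (cong (- (s + s) *_) W≡V) (sym (D-H k)))) ,
    *-cancel-⟦suc⟧ k (trans (D-W′ k) (trans (cong (λ x → (s + s) * ((x + x) - δ₀ k)) X≡H) (sym (D-V k))))

  product-error : 0ℚ ≤ s → ∃[ K ] (0ℚ ≤ K × (∀ n →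
    ∣ series cosₘ s n * series cosₘ s n - series cosₑ (s + s) n ∣ ≤ K * ½ ^ n))
  product-error s≥0 =
    let (C , C≥0 , ex≤) = ex-geometric² {2ℚ * s} (double≥0 s s≥0)
        A≤ = λ k → ℚ.≤-trans (term-bound {cosₘ} (returns-tame 1 1) {s} {s} s≥0 ℚ.≤-refl k) (ex≤ k)
        tail = λ {M} n n≤M → tail-bound {0} {C} {A} C≥0
          (λ k _ → ℚ.≤-trans (A≤ k) (*-monoʳ C C≥0
            (ℚ.≤-trans (*-monoʳ (½ ^ k) (½^-nonNeg k) (½^≤1 k)) (ℚ.≤-reflexive (ℚ.*-identityʳ (½ ^ k))))))
          {n} {M} ℕ.z≤n n≤M
        C[C+C]≥0 = *-nonNeg {C} {C + C} C≥0 (+-nonNeg {C} {C} C≥0 C≥0)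
    in C * (C + C) + C * (C + C) , +-nonNeg {C * (C + C)} {C * (C + C)} C[C+C]≥0 C[C+C]≥0 , λ n →
      subst (λ S → ∣ series cosₘ s n * series cosₘ s n - S ∣ ≤ (C * (C + C) + C * (C + C)) * ½ ^ n)
        (trans (triangle-conv A A n) (Σ<-cong n λ k _ → proj₁ (same k)))
        (cauchy-product {A} {A} {C} {C + C} {n} C≥0 A≤ (tail {n}) n ℕ.≤-refl)

cosₘ-vanishing : Vanishing cosₘ
cosₘ-vanishing = [ (λ { (inj₁ ()) ; (inj₂ ()) }) , id ]′ (returns-vanishing 1 1)

cosₑ-vanishing : Vanishing cosₑ
cosₑ-vanishing η η>0 =
  let ½η>0 = *-pos {½} {η} 0<½ η>0
      -- The cap at 1 gives c² ≤ |c| ≤ η/2; the other η/2 absorbs the error of the Cauchy product.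
      (s , s>0 , N , small) = cosₘ-vanishing (1ℚ ⊓ (½ * η)) (⊓-pos {1ℚ} {½ * η} (ℚ.positive⁻¹ 1ℚ) ½η>0)
      (K , K≥0 , err) = DoubleAngle.product-error s (ℚ.<⇒≤ s>0)
      (M , tiny) = ½^-null K {½ * η} K≥0 ½η>0
  in s + s , ℚ.+-mono-< s>0 s>0 , N ℕ.⊔ M , λ n N⊔M≤n → close (series cosₘ s n) (series cosₑ (s + s) n)
      (ℚ.≤-trans (small n (ℕ.m⊔n≤o⇒m≤o N M N⊔M≤n)) (ℚ.p⊓q≤p 1ℚ (½ * η)))
      (ℚ.≤-trans (small n (ℕ.m⊔n≤o⇒m≤o N M N⊔M≤n)) (ℚ.p⊓q≤q 1ℚ (½ * η)))
      (ℚ.≤-trans (err n) (tiny n (ℕ.m⊔n≤o⇒n≤o N M N⊔M≤n)))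
  where
  close : ∀ c e → ∣ c ∣ ≤ 1ℚ → ∣ c ∣ ≤ ½ * η → ∣ c * c - e ∣ ≤ ½ * η → ∣ e ∣ ≤ η
  close c e c≤1 c≤ ce≤ = subst₂ _≤_
    (cong ∣_∣ (solve 2 (λ x e → x :+ (e :- x) := e) refl (c * c) e))
    (solve 1 (λ η → con 1ℚ :* (con ½ :* η) :+ con ½ :* η := η) refl η)
    (+-mono-∣∣ {c * c} {e - c * c} (*-mono-∣∣ {c} {c} c≤1 c≤)
      (ℚ.≤-trans (ℚ.≤-reflexive (∣-∣-swap e (c * c))) ce≤))

Vanishing-cong : ∀ {c d} → (∀ k → c k ≡ d k) → Vanishing c → Vanishing d
Vanishing-cong c≗d v η η>0 = let (t , t>0 , N , small) = v η η>0 in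
  t , t>0 , N , λ n N≤n → subst (λ S → ∣ S ∣ ≤ η) (Σ<-cong n λ k _ → cong (_* ex t k) (c≗d k)) (small n N≤n)

-- A short case with l + r ≥ 2 has its nonzero arm of length exactly 2: it is an end of the path on
-- three vertices.
all-returns-vanish : ∀ l r → 2 ℕ.≤ l ℕ.+ r → Vanishing (returns l r)
all-returns-vanish l r l+r≥2 = [ short , id ]′ (returns-vanishing l r)
  where
  short : Short l r → Vanishing (returns l r)
  short (inj₁ (refl , r≤2)) = subst (λ r → Vanishing (returns 0 r)) (ℕ.≤-antisym l+r≥2 r≤2) cosₑ-vanishing
  short (inj₂ (refl , l≤2)) = subst (λ l → Vanishing (returns l 0))
    (ℕ.≤-antisym (subst (2 ℕ.≤_) (ℕ.+-identityʳ l) l+r≥2) l≤2)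
    (Vanishing-cong {returns 0 2} {returns 2 0} (λ k → cong (reI k *_) (walks-mirror k 0 0 0 2)) cosₑ-vanishing)

-- Factorials, and matrix powers as walk counts

1/m*⟦m⟧≡1 : ∀ m .{{_ : ℕ.NonZero m}} → (1ℤ ℚ./ m) * ⟦ m ⟧ ≡ 1ℚ
1/m*⟦m⟧≡1 (suc m) = trans (cong (_* ⟦ suc m ⟧) (ℚ.normalize-coprime (ℕ.1-coprimeTo (suc m))))
  (trans (ℚ.*-comm (recip m) ⟦ suc m ⟧) (recip-inverse m))

ex-! : ∀ t k → ex t k * ⟦ k ! ⟧ ≡ t ^ k
ex-! t zero    = refl
ex-! t (suc k) = begin
  ex t k * t * recip k * ⟦ suc k ℕ.* k ! ⟧
    ≡⟨ cong (ex t k * t * recip k *_) (⟦⟧-* (suc k) (k !)) ⟩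
  ex t k * t * recip k * (⟦ suc k ⟧ * ⟦ k ! ⟧)
    ≡⟨ solve 5 (λ e t r n f → e :* t :* r :* (n :* f) := (n :* r) :* (t :* (e :* f))) refl
         (ex t k) t (recip k) ⟦ suc k ⟧ ⟦ k ! ⟧ ⟩
  (⟦ suc k ⟧ * recip k) * (t * (ex t k * ⟦ k ! ⟧))
    ≡⟨ cong₂ _*_ (recip-inverse k) (cong (t *_) (ex-! t k)) ⟩
  1ℚ * (t * t ^ k)
    ≡⟨ ℚ.*-identityˡ (t * t ^ k) ⟩
  t * t ^ k ∎
  where open ≡-Reasoning

1/k!*t^k : ∀ t k → (1ℤ ℚ./ (k !)) {{k ℕ.!≢0}} * t ^ k ≡ ex t k
1/k!*t^k t k = begin
  r * t ^ k                ≡⟨ cong (r *_) (ex-! t k) ⟨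
  r * (ex t k * ⟦ k ! ⟧)   ≡⟨ solve 3 (λ r e f → r :* (e :* f) := e :* (r :* f)) refl r (ex t k) ⟦ k ! ⟧ ⟩
  ex t k * (r * ⟦ k ! ⟧)   ≡⟨ cong (ex t k *_) (1/m*⟦m⟧≡1 (k !) {{k ℕ.!≢0}}) ⟩
  ex t k * 1ℚ              ≡⟨ ℚ.*-identityʳ (ex t k) ⟩
  ex t k ∎
  where
  open ≡-Reasoning
  r = (1ℤ ℚ./ (k !)) {{k ℕ.!≢0}}

sum-toℕ : ∀ f n → sum {n} (f ∘ toℕ) ≡ Σ< f n
sum-toℕ f zero    = refl
sum-toℕ f (suc n) = trans (cong (f 0 +_) (sum-toℕ (f ∘ suc) n)) (sym (Σ<-head f n))

[_] : Bool → ℚ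
[ β ] = if β then 1ℚ else 0ℚ

sum-zero : ∀ {n} (h : Fin n → ℚ) → sum (λ c → 0ℚ * h c) ≡ 0ℚ
sum-zero h = trans (sym (*-distribˡ-sum 0ℚ h)) (ℚ.*-zeroˡ (sum h))

sum-point : ∀ m n (h : ℕ → ℚ) →
  sum {n} (λ c → [ m ℕ.≡ᵇ toℕ c ] * h (toℕ c)) ≡ (if m ℕ.<ᵇ n then h m else 0ℚ)
sum-point m       zero    h = refl
sum-point zero    (suc n) h = trans (cong (1ℚ * h 0 +_) (sum-zero {n} (h ∘ toℕ ∘ suc)))
  (solve 1 (λ h → con 1ℚ :* h :+ con 0ℚ := h) refl (h 0))
sum-point (suc m) (suc n) h = trans (cong (0ℚ * h 0 +_) (sum-point m n (h ∘ suc)))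
  (solve 2 (λ h z → con 0ℚ :* h :+ z := z) refl (h 0) (if m ℕ.<ᵇ n then h (suc m) else 0ℚ))

-- A vertex cannot lie on both sides of another one, so the indicator of the disjunction splits and
-- the neighbour sum falls into a left and a right part.
exclusive : ∀ a c → [ (suc a ℕ.≡ᵇ c) ∨ (suc c ℕ.≡ᵇ a) ] ≡ [ suc a ℕ.≡ᵇ c ] + [ suc c ℕ.≡ᵇ a ]
exclusive zero    zero          = refl
exclusive zero    (suc zero)    = refl
exclusive zero    (suc (suc c)) = refl
exclusive (suc zero) zero       = refl
exclusive (suc (suc a)) zero    = refl
exclusive (suc a) (suc c)       = exclusive a c

below : (ℕ → ℚ) → ℕ → ℚ
below h zero    = 0ℚ
below h (suc a) = h a

sum-below : ∀ n (h : ℕ → ℚ) (a : Fin n) → sum {n} (λ c → [ suc (toℕ c) ℕ.≡ᵇ toℕ a ] * h (toℕ c)) ≡ below h (toℕ a)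
sum-below n h a = at (toℕ a) (Fin.toℕ<n a)
  where
  at : ∀ a → a ℕ.< n → sum {n} (λ c → [ suc (toℕ c) ℕ.≡ᵇ a ] * h (toℕ c)) ≡ below h a
  at zero    _   = sum-zero {n} (h ∘ toℕ)
  at (suc a) a<n = trans (sum-cong-≗ {n} λ c → cong (λ β → [ β ] * h (toℕ c)) (≡ᵇ-sym (toℕ c) a))
    (trans (sum-point a n h) (cong (if_then h a else 0ℚ) (<⇒<ᵇ-true (ℕ.<-trans (ℕ.n<1+n a) a<n))))
    where
    <⇒<ᵇ-true : ∀ {p q} → p ℕ.< q → (p ℕ.<ᵇ q) ≡ true
    <⇒<ᵇ-true {zero}  {suc q} _           = refl
    <⇒<ᵇ-true {suc p} {suc q} (ℕ.s≤s p<q) = <⇒<ᵇ-true p<q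

module Path (n : ℕ) where

  adjacent : Fin n → Fin n → ℚ
  adjacent a c = [ does (adj? (P n) a c) ]

  sum-adjacent : ∀ (h : ℕ → ℚ) (a : Fin n) →
    sum (λ c → adjacent a c * h (toℕ c)) ≡
    below h (toℕ a) + (if suc (toℕ a) ℕ.<ᵇ n then h (suc (toℕ a)) else 0ℚ)
  sum-adjacent h a = trans
    (sum-cong-≗ {n} λ c → trans (cong (_* h (toℕ c)) (trans (exclusive (toℕ a) (toℕ c)) (ℚ.+-comm [ suc (toℕ a) ℕ.≡ᵇ toℕ c ] [ suc (toℕ c) ℕ.≡ᵇ toℕ a ])))
      (ℚ.*-distribʳ-+ (h (toℕ c)) [ suc (toℕ c) ℕ.≡ᵇ toℕ a ] [ suc (toℕ a) ℕ.≡ᵇ toℕ c ]))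
    (trans (∑-distrib-+ {n} (λ c → [ suc (toℕ c) ℕ.≡ᵇ toℕ a ] * h (toℕ c)) (λ c → [ suc (toℕ a) ℕ.≡ᵇ toℕ c ] * h (toℕ c)))
      (cong₂ _+_ (sum-below n h a) (sum-point (suc (toℕ a)) n h)))

  walksBetween : ℕ → Fin n → Fin n → ℚ
  walksBetween k a b = walks k (toℕ a) (toℕ b) (toℕ a) (n ℕ.∸ suc (toℕ a))

  sum-walks : ∀ k a b → sum (λ c → adjacent a c * walksBetween k c b) ≡ walksBetween (suc k) a b
  sum-walks k a b = trans (sum-adjacent h a) (cong₂ _+_ (left (toℕ a) (Fin.toℕ<n a)) (right (toℕ a) (Fin.toℕ<n a)))
    where
    h : ℕ → ℚ
    h c = walks k c (toℕ b) c (n ℕ.∸ suc c)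
    ∸-suc : ∀ {m} → m ℕ.< n → n ℕ.∸ m ≡ suc (n ℕ.∸ suc m)
    ∸-suc m<n = ℕ.+-∸-assoc 1 m<n
    left : ∀ a → a ℕ.< n → below h a ≡ leftward k a (toℕ b) a (n ℕ.∸ suc a)
    left zero    _   = refl
    left (suc a) a<n = trans (cong (walks k a (toℕ b) a) (∸-suc a<n)) (sym (walks-shift k a (toℕ b) a (suc (n ℕ.∸ suc (suc a)))))
    right : ∀ a → a ℕ.< n → (if suc a ℕ.<ᵇ n then h (suc a) else 0ℚ) ≡ rightward k a (toℕ b) a (n ℕ.∸ suc a)
    right a a<n with suc a ℕ.<ᵇ n in eq
    ... | true  = sym (cong (rightward k a (toℕ b) a) (∸-suc (ℕ.<ᵇ⇒< (suc a) n (subst T (sym eq) _))))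
    ... | false = sym (cong (rightward k a (toℕ b) a) (ℕ.m≤n⇒m∸n≡0 {n} {suc a} (ℕ.≮⇒≥ λ lt → subst T eq (ℕ.<⇒<ᵇ lt))))

-- Limits of the series as real numbers

series-cauchy : ∀ {c} → Tame c → ∀ {t} → 0ℚ ≤ t → ∀ {η} → 0ℚ < η →
  ∃[ N ] (∀ m n → N ℕ.≤ m → N ℕ.≤ n → ∣ series c t m - series c t n ∣ ≤ η)
series-cauchy {c} tame {t} t≥0 {η} η>0 =
  let (N , near) = series-uniform {c} tame {t} {½ * η} t≥0 (*-pos {½} {η} 0<½ η>0)
  in N , λ m n N≤m N≤n → subst₂ _≤_
    (cong ∣_∣ (solve 3 (λ a b z → (a :- z) :+ (z :- b) := a :- b) refl (series c t m) (series c t n) (series c t N)))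
    (solve 1 (λ η → con ½ :* η :+ con ½ :* η := η) refl η)
    (+-mono-∣∣ {series c t m - series c t N} {series c t N - series c t n}
      (near t≥0 ℚ.≤-refl ℕ.≤-refl N≤m)
      (ℚ.≤-trans (ℚ.≤-reflexive (∣-∣-swap (series c t N) (series c t n))) (near t≥0 ℚ.≤-refl ℕ.≤-refl N≤n)))

½*<self : ∀ {ε} → 0ℚ < ε → ½ * ε < ε
½*<self {ε} ε>0 = subst (½ * ε <_) (ℚ.*-identityˡ ε)
  (ℚ.*-monoˡ-<-pos ε {{positive ε>0}} (from-yes (½ ℚ.<? 1ℚ)))

≤⇒IsCauchy : ∀ {x} → (∀ {η} → 0ℚ < η → ∃[ N ] (∀ m n → N ℕ.≤ m → N ℕ.≤ n → ∣ x m - x n ∣ ≤ η)) → IsCauchy x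
≤⇒IsCauchy close ε ε>0 = let (N , near) = close {½ * ε} (*-pos {½} {ε} 0<½ ε>0) in
  N , λ m n N≤m N≤n → ℚ.≤-<-trans (near m n N≤m N≤n) (½*<self ε>0)

limit : ∀ c → Tame c → ∀ t → 0ℚ ≤ t → ℝ
limit c tame t t≥0 = mkℝ (series c t) (≤⇒IsCauchy {series c t} (series-cauchy {c} tame {t} t≥0))

∣∣-difference : ∀ p q → ∣ ∣ p ∣ - ∣ q ∣ ∣ ≤ ∣ p - q ∣
∣∣-difference p q = ∣p∣≤ (one-sided p q)
  (≤-transfer (one-sided q p) (trans (cong (- ∣ p - q ∣ +_) (∣-∣-swap q p))
    (solve 3 (λ d p q → (:- d) :+ d := (p :- q) :+ (q :- p)) refl (∣ p - q ∣) (∣ p ∣) (∣ q ∣))))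
  where
  one-sided : ∀ p q → ∣ p ∣ - ∣ q ∣ ≤ ∣ p - q ∣
  one-sided p q = ≤-transfer (ℚ.∣p+q∣≤∣p∣+∣q∣ (p - q) q)
    (trans (solve 3 (λ p q d → (p :- q) :+ (d :+ q) := d :+ p) refl (∣ p ∣) (∣ q ∣) (∣ p - q ∣))
      (cong (λ z → ∣ p - q ∣ + ∣ z ∣) (solve 2 (λ p q → p := (p :- q) :+ q) refl p q)))

-- Diagonal entries are real, so their modulus is an absolute value and can be taken on each partial
-- sum, without extracting a square root.
∣limit∣ : ∀ c → Tame c → ∀ t → 0ℚ ≤ t → ℝ
∣limit∣ c tame t t≥0 = mkℝ (λ m → ∣ series c t m ∣) (≤⇒IsCauchy {λ m → ∣ series c t m ∣} λ η>0 →
  let (N , near) = series-cauchy {c} tame {t} t≥0 η>0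
  in N , λ m n N≤m N≤n → ℚ.≤-trans (∣∣-difference (series c t m) (series c t n)) (near m n N≤m N≤n))

≗⇒≤ : ∀ {x y} → (∀ m → seq x m ≡ seq y m) → x Def.≤ y
≗⇒≤ {x} {y} x≗y ε ε>0 = 0 , λ m _ → subst (_< seq y m + ε) (trans (ℚ.+-identityʳ (seq y m)) (sym (x≗y m)))
  (ℚ.+-monoʳ-< (seq y m) ε>0)

≗⇒≈ : ∀ {x y} → (∀ m → seq x m ≡ seq y m) → x Def.≈ y
≗⇒≈ {x} {y} x≗y = ≗⇒≤ {x} {y} x≗y , ≗⇒≤ {y} {x} (sym ∘ x≗y)

re# im# : ℂ → ℕ → ℚ
re# z = seq (re z)
im# z = seq (im z)

re#-sum : ∀ {n} (v : Fin n → ℂ) m → re# (ℂR.sum v) m ≡ sum (λ c → re# (v c) m)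
re#-sum {zero}  v m = refl
re#-sum {suc n} v m = cong (re# (v zero) m +_) (re#-sum (v ∘ suc) m)

im#-sum : ∀ {n} (v : Fin n → ℂ) m → im# (ℂR.sum v) m ≡ sum (λ c → im# (v c) m)
im#-sum {zero}  v m = refl
im#-sum {suc n} v m = cong (im# (v zero) m +_) (im#-sum (v ∘ suc) m)

-- Every number occurring in the partial sums is a constant sequence.
module Exponential (n : ℕ) (t : ℚ) where

  open Path n
  open RawSemiringDefs (RawRing.rawSemiring (Matrix-rawRing n))
    using () renaming (sum to Σᴹ; _^_ to _^ᴹ_)

  M : Matrix n
  M = (Def.i ℂR.* fromℝ (fromℚ t)) · adjacencyMatrix (P n)

  re#-M : ∀ a c m → re# (M a c) m ≡ 0ℚ
  re#-M a c m = at (does (adj? (P n) a c))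
    where
    at : ∀ β → re# ((Def.i ℂR.* fromℝ (fromℚ t)) ℂR.* (if β then ℂR.1# else ℂR.0#)) m ≡ 0ℚ
    at true  = solve 1 (λ t → (con 0ℚ :* t :+ :- (con 1ℚ :* con 0ℚ)) :* con 1ℚ :+ :- ((con 0ℚ :* con 0ℚ :+ con 1ℚ :* t) :* con 0ℚ) := con 0ℚ) refl t
    at false = solve 1 (λ t → (con 0ℚ :* t :+ :- (con 1ℚ :* con 0ℚ)) :* con 0ℚ :+ :- ((con 0ℚ :* con 0ℚ :+ con 1ℚ :* t) :* con 0ℚ) := con 0ℚ) refl t

  im#-M : ∀ a c m → im# (M a c) m ≡ t * adjacent a c
  im#-M a c m = at (does (adj? (P n) a c))
    where
    at : ∀ β → im# ((Def.i ℂR.* fromℝ (fromℚ t)) ℂR.* (if β then ℂR.1# else ℂR.0#)) m ≡ t * [ β ]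
    at true  = solve 1 (λ t → (con 0ℚ :* t :+ :- (con 1ℚ :* con 0ℚ)) :* con 0ℚ :+ (con 0ℚ :* con 0ℚ :+ con 1ℚ :* t) :* con 1ℚ := t :* con 1ℚ) refl t
    at false = solve 1 (λ t → (con 0ℚ :* t :+ :- (con 1ℚ :* con 0ℚ)) :* con 0ℚ :+ (con 0ℚ :* con 0ℚ :+ con 1ℚ :* t) :* con 0ℚ := t :* con 0ℚ) refl t

  -- Here (itA)^k = i^k t^k A^k, and the entries of A^k count walks. The two parts are proved
  -- together because each factor i exchanges them.
  re#-^ : ∀ k a b m → re# ((M ^ᴹ k) a b) m ≡ reI k * (t ^ k * walksBetween k a b)
  im#-^ : ∀ k a b m → im# ((M ^ᴹ k) a b) m ≡ imI k * (t ^ k * walksBetween k a b)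
  re#-^ zero a b m = trans (at (does (a Fin.≟ b)))
    (trans (cong [_] (≟-≡ᵇ a b)) (solve 1 (λ w → w := con 1ℚ :* (con 1ℚ :* w)) refl [ toℕ a ℕ.≡ᵇ toℕ b ]))
    where
    at : ∀ β → re# (if β then ℂR.1# else ℂR.0#) m ≡ [ β ]
    at true  = refl
    at false = refl
    ≟-≡ᵇ : ∀ {n} (a b : Fin n) → does (a Fin.≟ b) ≡ (toℕ a ℕ.≡ᵇ toℕ b)
    ≟-≡ᵇ zero    zero    = refl
    ≟-≡ᵇ zero    (suc b) = refl
    ≟-≡ᵇ (suc a) zero    = refl
    ≟-≡ᵇ (suc a) (suc b) = ≟-≡ᵇ a b
  re#-^ (suc k) a b m = trans (re#-sum (λ c → M a c ℂR.* (M ^ᴹ k) c b) m)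
    (trans (sum-cong-≗ {n} λ c → trans
        (cong₂ _+_ (cong (_* re# ((M ^ᴹ k) c b) m) (re#-M a c m))
                   (cong -_ (cong₂ _*_ (im#-M a c m) (im#-^ k c b m))))
        (solve 6 (λ z t g j p w → con 0ℚ :* z :+ :- ((t :* g) :* (j :* (p :* w))) := ((:- j) :* (t :* p)) :* (g :* w)) refl
          (re# ((M ^ᴹ k) c b) m) t (adjacent a c) (imI k) (t ^ k) (walksBetween k c b)))
      (trans (sym (*-distribˡ-sum (- imI k * (t * t ^ k)) (λ c → adjacent a c * walksBetween k c b)))
        (trans (cong (- imI k * (t * t ^ k) *_) (sum-walks k a b))
          (ℚ.*-assoc (- imI k) (t * t ^ k) (walksBetween (suc k) a b)))))
  im#-^ zero a b m = trans (at (does (a Fin.≟ b))) (sym (ℚ.*-zeroˡ (1ℚ * walksBetween 0 a b)))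
    where
    at : ∀ β → im# (if β then ℂR.1# else ℂR.0#) m ≡ 0ℚ
    at true  = refl
    at false = refl
  im#-^ (suc k) a b m = trans (im#-sum (λ c → M a c ℂR.* (M ^ᴹ k) c b) m)
    (trans (sum-cong-≗ {n} λ c → trans
        (cong₂ _+_ (cong (_* im# ((M ^ᴹ k) c b) m) (re#-M a c m))
                   (cong₂ _*_ (im#-M a c m) (re#-^ k c b m)))
        (solve 6 (λ z t g j p w → con 0ℚ :* z :+ (t :* g) :* (j :* (p :* w)) := (j :* (t :* p)) :* (g :* w)) refl
          (im# ((M ^ᴹ k) c b) m) t (adjacent a c) (reI k) (t ^ k) (walksBetween k c b)))
      (trans (sym (*-distribˡ-sum (reI k * (t * t ^ k)) (λ c → adjacent a c * walksBetween k c b)))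
        (trans (cong (reI k * (t * t ^ k) *_) (sum-walks k a b))
          (ℚ.*-assoc (reI k) (t * t ^ k) (walksBetween (suc k) a b)))))

  reC imC : Fin n → Fin n → ℕ → ℚ
  reC a b k = reI k * walksBetween k a b
  imC a b k = imI k * walksBetween k a b

  reC-tame : ∀ a b → Tame (reC a b)
  reC-tame a b = scaled-tame reI (λ k → walksBetween k a b) ∣reI∣≤1 λ k → walks-bound k _ _ _ _

  imC-tame : ∀ a b → Tame (imC a b)
  imC-tame a b = scaled-tame imI (λ k → walksBetween k a b) ∣imI∣≤1 λ k → walks-bound k _ _ _ _

  re#-Σᴹ : ∀ {N} (v : Fin N → Matrix n) a b m → re# (Σᴹ v a b) m ≡ sum (λ k → re# (v k a b) m)
  re#-Σᴹ {zero}  v a b m = refl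
  re#-Σᴹ {suc N} v a b m = cong (re# (v zero a b) m +_) (re#-Σᴹ (v ∘ suc) a b m)

  im#-Σᴹ : ∀ {N} (v : Fin N → Matrix n) a b m → im# (Σᴹ v a b) m ≡ sum (λ k → im# (v k a b) m)
  im#-Σᴹ {zero}  v a b m = refl
  im#-Σᴹ {suc N} v a b m = cong (im# (v zero a b) m +_) (im#-Σᴹ (v ∘ suc) a b m)

  re#-exp : ∀ N a b m → re# (expPartialSum M N a b) m ≡ series (reC a b) t N
  re#-exp N a b m = trans (re#-Σᴹ {N} (λ k → 1/ toℕ k ! · (M ^ᴹ toℕ k)) a b m)
    (trans (sum-cong-≗ {N} (λ k → at (toℕ k))) (sum-toℕ (term (reC a b) t) N))
    where
    at : ∀ k → re# (1/ k ! ℂR.* (M ^ᴹ k) a b) m ≡ term (reC a b) t k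
    at k = trans (cong (λ z → r * z + - (0ℚ * im# ((M ^ᴹ k) a b) m)) (re#-^ k a b m))
      (trans (solve 5 (λ r j p w z → r :* (j :* (p :* w)) :+ :- (con 0ℚ :* z) := j :* w :* (r :* p)) refl
          r (reI k) (t ^ k) (walksBetween k a b) (im# ((M ^ᴹ k) a b) m))
        (cong (reC a b k *_) (1/k!*t^k t k)))
      where r = (1ℤ ℚ./ (k !)) {{k ℕ.!≢0}}

  im#-exp : ∀ N a b m → im# (expPartialSum M N a b) m ≡ series (imC a b) t N
  im#-exp N a b m = trans (im#-Σᴹ {N} (λ k → 1/ toℕ k ! · (M ^ᴹ toℕ k)) a b m)
    (trans (sum-cong-≗ {N} (λ k → at (toℕ k))) (sum-toℕ (term (imC a b) t) N))
    where
    at : ∀ k → im# (1/ k ! ℂR.* (M ^ᴹ k) a b) m ≡ term (imC a b) t k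
    at k = trans (cong (λ z → r * z + 0ℚ * re# ((M ^ᴹ k) a b) m) (im#-^ k a b m))
      (trans (solve 5 (λ r j p w z → r :* (j :* (p :* w)) :+ con 0ℚ :* z := j :* w :* (r :* p)) refl
          r (imI k) (t ^ k) (walksBetween k a b) (re# ((M ^ᴹ k) a b) m))
        (cong (imC a b k *_) (1/k!*t^k t k)))
      where r = (1ℤ ℚ./ (k !)) {{k ℕ.!≢0}}

-- The transition matrix and its diagonal

square-≤ : ∀ {p a} → ∣ p ∣ ≤ a → p * p ≤ a * a
square-≤ {p} {a} p≤a = ℚ.≤-trans (p≤∣p∣ (p * p)) (*-mono-∣∣ {p} {p} p≤a p≤a)

square-< : ∀ {p q} → 0ℚ < p → p < q → p * p < q * q
square-< {p} {q} p>0 p<q = ℚ.<-trans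
  (ℚ.*-monoʳ-<-pos p {{positive p>0}} p<q)
  (ℚ.*-monoˡ-<-pos q {{positive (ℚ.<-trans p>0 p<q)}} p<q)

module Transition (n : ℕ) (t : ℚ) (t≥0 : 0ℚ ≤ t) where

  open Path n
  open Exponential n t

  U : Matrix n
  U a b = limit (reC a b) (reC-tame a b) t t≥0 +i limit (imC a b) (imC-tame a b) t t≥0

  U-transition : IsTransition (P n) (fromℚ t) U
  U-transition a b ε (e , e>0 , K , e<ε) =
    let ½e>0 = *-pos {½} {e} 0<½ e>0
        (N , re-near) = series-cauchy {reC a b} (reC-tame a b) {t} t≥0 ½e>0
        (N′ , im-near) = series-cauchy {imC a b} (imC-tame a b) {t} t≥0 ½e>0
    -- Coordinates within e/2 give a squared distance of at most e²/2; the remaining e²/2 is the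
    -- rational gap that `<` on `ℝ` demands.
    in N ℕ.⊔ N′ , λ m m≥ → ½ * (e * e) , *-pos {½} {e * e} 0<½ (*-pos {e} {e} e>0 e>0) ,
      (N ℕ.⊔ N′) ℕ.⊔ K , λ k k≥ →
        let k≥NN′ = ℕ.m⊔n≤o⇒m≤o (N ℕ.⊔ N′) K k≥ in
        distance-< (seq ε k) (re#-exp m a b k) (im#-exp m a b k)
          (re-near m k (ℕ.m⊔n≤o⇒m≤o N N′ m≥) (ℕ.m⊔n≤o⇒m≤o N N′ k≥NN′))
          (im-near m k (ℕ.m⊔n≤o⇒n≤o N N′ m≥) (ℕ.m⊔n≤o⇒n≤o N N′ k≥NN′))
          (subst (_< seq ε k) (ℚ.+-identityˡ e) (e<ε k (ℕ.m⊔n≤o⇒n≤o (N ℕ.⊔ N′) K k≥)))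
    where
    distance-< : ∀ {x x′ y y′ x₀ y₀} z → x ≡ x′ → y ≡ y′ →
      ∣ x′ - x₀ ∣ ≤ ½ * e → ∣ y′ - y₀ ∣ ≤ ½ * e → e < z →
      (x + - x₀) * (x + - x₀) + (y + - y₀) * (y + - y₀) + ½ * (e * e) < z * z
    distance-< {x} {y = y} {x₀ = x₀} {y₀} z refl refl dx dy e<z = begin-strict
      (x + - x₀) * (x + - x₀) + (y + - y₀) * (y + - y₀) + ½ * (e * e)
        ≤⟨ ℚ.+-monoˡ-≤ (½ * (e * e)) (ℚ.+-mono-≤ (square-≤ {x - x₀} dx) (square-≤ {y - y₀} dy)) ⟩
      (½ * e) * (½ * e) + (½ * e) * (½ * e) + ½ * (e * e)
        ≡⟨ solve 1 (λ e → (con ½ :* e) :* (con ½ :* e) :+ (con ½ :* e) :* (con ½ :* e) :+ con ½ :* (e :* e) := e :* e) refl e ⟩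
      e * e
        <⟨ square-< e>0 e<z ⟩
      z * z ∎
      where open ≤-Reasoning

  module _ (u : Fin n) where

    diagonal : ∀ k → walksBetween k u u ≡ walks k 0 0 (toℕ u) (n ℕ.∸ suc (toℕ u))
    diagonal k = walks-diagonal k (toℕ u) (toℕ u) (n ℕ.∸ suc (toℕ u))

    reC-returns : ∀ k → reC u u k ≡ returns (toℕ u) (n ℕ.∸ suc (toℕ u)) k
    reC-returns k = cong (reI k *_) (diagonal k)

    im-zero : ∀ m → series (imC u u) t m ≡ 0ℚ
    im-zero zero    = refl
    im-zero (suc m) = cong₂ _+_ (im-zero m) (trans
      (cong (_* ex t m) (trans (cong (imI m *_) (diagonal m)) (imI*walks≡0 m (toℕ u) (n ℕ.∸ suc (toℕ u)))))
      (ℚ.*-zeroˡ (ex t m)))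

    ∣U∣ : ℝ
    ∣U∣ = ∣limit∣ (reC u u) (reC-tame u u) t t≥0

    ∣U∣-modulus : IsModulus (U u u) ∣U∣
    ∣U∣-modulus = (λ ε ε>0 → 0 , λ m _ → ℚ.+-mono-≤-< (ℚ.0≤∣p∣ (series (reC u u) t m)) ε>0) ,
      ≗⇒≈ {∣U∣ Def.* ∣U∣} {∣ U u u ∣²} λ m →
        trans (square-∣∣ (series (reC u u) t m))
          (trans (sym (ℚ.+-identityʳ _)) (cong (series (reC u u) t m * series (reC u u) t m +_)
            (sym (cong (λ z → z * z) (im-zero m)))))
      where
      square-∣∣ : ∀ p → ∣ p ∣ * ∣ p ∣ ≡ p * p
      square-∣∣ p with ℚ.∣p∣≡p∨∣p∣≡-p p
      ... | inj₁ e = cong (λ z → z * z) e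
      ... | inj₂ e = trans (cong (λ z → z * z) e) (solve 1 (λ p → (:- p) :* (:- p) := p :* p) refl p)

theorem43 : (n : ℕ) → n ≥ℕ 3 → (u : Fin n) → NotSedentary (P n) u
theorem43 n n≥3 u = (λ { r (_ , _ , _ , _ , r≥0 , _) → r≥0 }) , λ ε (e , e>0 , K , e<ε) →
  let (t , t>0 , N , small) = all-returns-vanish (toℕ u) (n ℕ.∸ suc (toℕ u))
        -- The two arms of u have n - 1 ≥ 2 vertices in all.
        (ℕ.s≤s⁻¹ (subst (3 ℕ.≤_) (sym (ℕ.m+[n∸m]≡n (Fin.toℕ<n u))) n≥3))
        (½ * e) (*-pos {½} {e} 0<½ e>0)
      open Transition n t (ℚ.<⇒≤ t>0)
      open Exponential n t using (reC)
  in ∣U∣ u ,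
    (fromℚ t ,
     (½ * t , *-pos {½} {t} 0<½ t>0 , 0 , λ _ _ → subst (_< t) (sym (ℚ.+-identityˡ (½ * t))) (½*<self t>0)) ,
     U , U-transition , ∣U∣-modulus u) ,
    -- One half of e bounds the modulus, the other is the gap in the strict inequality.
    (½ * e , *-pos {½} {e} 0<½ e>0 , N ℕ.⊔ K , λ m m≥ → close {∣ series (reC u u) t m ∣} {e} {seq ε m}
      (subst (λ S → ∣ S ∣ ≤ ½ * e) (sym (Σ<-cong m λ k _ → cong (_* ex t k) (reC-returns u k)))
        (small m (ℕ.m⊔n≤o⇒m≤o N K m≥)))
      (e<ε m (ℕ.m⊔n≤o⇒n≤o N K m≥)))
  where
  close : ∀ {a e z} → a ≤ ½ * e → 0ℚ + e < z → a + ½ * e < 0ℚ + z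
  close {a} {e} {z} a≤ e<z = ℚ.≤-<-trans
    (≤-transfer a≤ (solve 2 (λ a e → a :+ con ½ :* e :+ con ½ :* e := (con 0ℚ :+ e) :+ a) refl a e))
    (subst (0ℚ + e <_) (sym (ℚ.+-identityˡ z)) e<z)
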